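{- Let $r>0$ and let $(X,\{R_i\}_{i=0}^4)$ be a $Q$-polynomial association scheme with Krein array $\{r^2-4,\ r^2-9,\ 10,\ 1;\ 1,\ 2,\ r^2-9,\ r^2-4\}$. Then $r=9$.
   Context: An association scheme $(X,\{R_i\}_{i=0}^D)$: a finite set $X$ with non-empty relations $R_i$ whose adjacency matrices $A_i$ satisfy $A_0=I$, $\sum A_i=J$, $A_i^\top=A_i$, $A_iA_j=\sum_k p_{ij}^kA_k$ with nonnegative integers $p_{ij}^k$; the algebra they span has primitive idempotents $E_0=\frac1{|X|}J,E_1,\dots,E_D$. Krein parameters $q_{ij}^k$ are defined by $E_i\circ E_j=\frac1{|X|}\sum_k q_{ij}^kE_k$ ($\circ$ the entrywise product). The scheme is $Q$-polynomial with respect to an ordering $E_0,\dots,E_D$ iff the matrix $(q_{1j}^k)_{k,j}$ is tridiagonal with nonzero sub- and superdiagonals; its Krein array is then $\{b_0^*,\ldots,b_{D-1}^*;c_1^*,\ldots,c_D^*\}$ where $b_i^*=q_{1,i+1}^i$ and $c_i^*=q_{1,i-1}^i$. -}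

module Defs where

open import Level using (Level; _⊔_) renaming (suc to lsuc)
open import Algebra.Bundles using (CommutativeRing)
open import Relation.Binary.Core using (Rel)
open import Relation.Binary.Structures using (IsStrictTotalOrder)
open import Relation.Binary.PropositionalEquality using (_≡_)
open import Relation.Nullary using (¬_)
open import Data.Nat using (ℕ; zero; suc) renaming (_+_ to _+ℕ_; _*_ to _*ℕ_; _<_ to _<ℕ_)
open import Data.Fin using (Fin; zero; suc; toℕ; inject₁; _≟_)
open import Data.Product using (Σ; ∃; _×_; _,_)
open import Data.Sum using (_⊎_)
open import Relation.Nullary.Decidable using (does)
open import Data.Bool using (Bool; true; false; if_then_else_; _∧_)

count : ∀ {n} → (Fin n → Bool) → ℕ
count {zero}  P = 0
count {suc n} P = (if P zero then 1 else 0) +ℕ count (λ i → P (suc i))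

-- Real closed fields (an ordered field in which every positive element
-- has a square root and every monic odd-degree polynomial has a root).
-- Stands in for ℝ.

module RingOps {c ℓ} (R : CommutativeRing c ℓ) where
  open CommutativeRing R using (Carrier; _+_; _*_; 0#; 1#)
  Σ[<_]_ : (k : ℕ) → (Fin k → Carrier) → Carrier
  Σ[< zero ] f = 0#
  Σ[< suc k ] f = f zero + Σ[< k ] (λ i → f (suc i))

  pow : Carrier → ℕ → Carrier
  pow x zero = 1#
  pow x (suc k) = x * pow x k

  fromℕ : ℕ → Carrier
  fromℕ zero = 0#
  fromℕ (suc k) = 1# + fromℕ k


record RealClosedField c ℓ₁ ℓ₂ : Set (lsuc (c ⊔ ℓ₁ ⊔ ℓ₂)) where
  field
    commutativeRing : CommutativeRing c ℓ₁
  open CommutativeRing commutativeRing public hiding (zero)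
  open RingOps commutativeRing public

  field
    _<_ : Rel Carrier ℓ₂
    isStrictTotalOrder : IsStrictTotalOrder _≈_ _<_
    +-mono-< : ∀ {x y} z → x < y → (x + z) < (y + z)
    *-pos : ∀ {x y} → 0# < x → 0# < y → 0# < (x * y)
    nontrivial : ¬ (1# ≈ 0#)
    inverse : ∀ x → ¬ (x ≈ 0#) → ∃ λ y → (x * y) ≈ 1#
    sqrt : ∀ x → 0# < x → ∃ λ y → (y * y) ≈ x
    odd-root : ∀ (k : ℕ) (a : Fin (suc (2 *ℕ k)) → Carrier) →
               ∃ λ x → (pow x (suc (2 *ℕ k)) + Σ[< suc (2 *ℕ k) ] (λ i → a i * pow x (toℕ i))) ≈ 0#

-- Symmetric association schemes with classes R_0, …, R_D on X = Fin n,
-- given by the relation-index function rel : X → X → Fin (suc D)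
-- ((x , y) ∈ R_i  iff  rel x y ≡ i).  Since each pair lies in exactly one
-- R_i, the adjacency matrices automatically sum to J.

record AssociationScheme (n D : ℕ) : Set where
  field
    rel : Fin n → Fin n → Fin (suc D)
    rel-diag : ∀ x y → (rel x y ≡ zero → x ≡ y) × (x ≡ y → rel x y ≡ zero)
    rel-sym : ∀ x y → rel x y ≡ rel y x
    nonempty : ∀ i → Σ (Fin n) λ x → Σ (Fin n) λ y → rel x y ≡ i
    -- intersection numbers: (A_i A_j)_{xy} = #{z | x R_i z, z R_j y} = p_{ij}^k
    -- whenever (x,y) ∈ R_k, i.e. A_i A_j = Σ_k p_{ij}^k A_k
    p : Fin (suc D) → Fin (suc D) → Fin (suc D) → ℕ
    p-prop : ∀ i j k x y → rel x y ≡ k →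
             count (λ z → does (rel x z ≟ i) ∧ does (rel z y ≟ j)) ≡ p i j k

module _ {c ℓ₁ ℓ₂} (F : RealClosedField c ℓ₁ ℓ₂) where
  open RealClosedField F

  Mat : ℕ → Set c
  Mat n = Fin n → Fin n → Carrier

  _≈M_ : ∀ {n} → Mat n → Mat n → Set ℓ₁
  M ≈M N = ∀ x y → M x y ≈ N x y

  _·M_ : ∀ {n} → Mat n → Mat n → Mat n
  _·M_ {n} M N x y = Σ[< n ] (λ z → M x z * N z y)

  _∘M_ : ∀ {n} → Mat n → Mat n → Mat n
  (M ∘M N) x y = M x y * N x y

  _⊛_ : ∀ {n} → Carrier → Mat n → Mat n
  (a ⊛ M) x y = a * M x y

  zeroM : ∀ {n} → Mat n
  zeroM x y = 0#

  idM : ∀ {n} → Mat n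
  idM x y = if does (x ≟ y) then 1# else 0#

  allOnes : ∀ {n} → Mat n
  allOnes x y = 1#

  ΣM : ∀ {n} (k : ℕ) → (Fin k → Mat n) → Mat n
  ΣM k M x y = Σ[< k ] (λ i → M i x y)

  adjacency : ∀ {n D} → AssociationScheme n D → Fin (suc D) → Mat n
  adjacency S i x y = if does (AssociationScheme.rel S x y ≟ i) then 1# else 0#

  record IsPrimitiveIdempotents {n D} (S : AssociationScheme n D)
         (E : Fin (suc D) → Mat n) : Set (c ⊔ ℓ₁) where
    field
      in-algebra : ∀ i → Σ (Fin (suc D) → Carrier) λ a →
                   E i ≈M ΣM (suc D) (λ j → a j ⊛ adjacency S j)
      orthogonal-idempotent : ∀ i j →
                   (i ≡ j → (E i ·M E j) ≈M E i) × (¬ i ≡ j → (E i ·M E j) ≈M zeroM)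
      nonzero : ∀ i → ¬ (E i ≈M zeroM)
      complete : ΣM (suc D) E ≈M idM
      E₀ : (fromℕ n ⊛ E zero) ≈M allOnes

  IsKreinParameters : ∀ {n D} → (Fin (suc D) → Mat n) →
                      (Fin (suc D) → Fin (suc D) → Fin (suc D) → Carrier) → Set ℓ₁
  IsKreinParameters {n} {D} E q = ∀ i j →
    (fromℕ n ⊛ (E i ∘M E j)) ≈M ΣM (suc D) (λ k → q i j k ⊛ E k)

  IsQPolynomial : ∀ {D'} → (Fin (suc (suc D')) → Fin (suc (suc D')) → Fin (suc (suc D')) → Carrier) → Set ℓ₁
  IsQPolynomial q = ∀ j k →
    ((suc (toℕ j) <ℕ toℕ k ⊎ suc (toℕ k) <ℕ toℕ j) → q (suc zero) j k ≈ 0#) ×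
    ((toℕ k ≡ suc (toℕ j) ⊎ toℕ j ≡ suc (toℕ k)) → ¬ (q (suc zero) j k ≈ 0#))

  -- Krein array entries: b*_i = q_{1,i+1}^i (0 ≤ i < D), c*_{i+1} = q_{1,i}^{i+1} (0 ≤ i < D)
  bStar : ∀ {D'} → (Fin (suc (suc D')) → Fin (suc (suc D')) → Fin (suc (suc D')) → Carrier) →
          Fin (suc D') → Carrier
  bStar q i = q (suc zero) (suc i) (inject₁ i)

  cStar : ∀ {D'} → (Fin (suc (suc D')) → Fin (suc (suc D')) → Fin (suc (suc D')) → Carrier) →
          Fin (suc D') → Carrier
  cStar q i = q (suc zero) (inject₁ i) (suc i)

{-# OPTIONS --safe #-}

-- Put s = r² and Qᵢ = |X| Eᵢ.  The Krein array forces Q₄ to take only the values 5 and -1, so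
-- Q₄ = 5 is an equivalence relation with six classes, and off the diagonal
-- Q₁ + Q₄ - 1 = r ε with ε = ±1.  Since q₁₁⁴ = q₁₂⁴ = 0, the cubic form
-- (u, v, w) ↦ Σ_z Q₁(u,z) Q₁(v,z) Q₁(w,z) is the same for z running over any one class.
-- For u, v, w in different classes, comparing the class of u with a fourth class turns this
-- into 2r(Z′ - Z) + 2s ab = (s - 1)(6 + r e), where Z, Z′ are integers (sums of products of
-- signs) and a, b, e are signs.  Sums of one and two signs show that s and r(s - 1) are
-- integers, so s divides 36, and all divisors are excluded: in fact no such scheme exists,
-- not even for r = 9.

module Submission where

open import Defs
open import Data.Nat using (ℕ; zero; suc)
open import Data.Fin using (Fin; zero; suc; toℕ; fromℕ<; _≟_)
import Data.Nat as ℕ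
import Data.Nat.Properties as ℕₚ
open import Data.Nat.Divisibility using (_∣_; _∣?_; divides; ∣⇒≤)
open import Data.Fin.Patterns using (0F; 1F; 2F; 3F; 4F)
open import Data.Fin.Properties using (all?; toℕ-fromℕ<)
open import Data.Integer using (ℤ; +_; -[1+_]; _⊖_; _◃_; ∣_∣)
import Data.Integer as ℤ
import Data.Integer.Properties as ℤₚ
import Data.Sign as Sign
open import Data.List using ([]; _∷_)
open import Data.List.Relation.Unary.Any using (here; there)
open import Data.List.Membership.Propositional using (_∈_)
open import Data.List.Membership.DecPropositional ℕ._≟_ using (_∈?_)
open import Data.Maybe using (Maybe; just; nothing)
open import Data.Product using (Σ; ∃; _×_; _,_; proj₁; proj₂)
open import Data.Sum using (_⊎_; inj₁; inj₂; [_,_]′)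
open import Data.Empty using (⊥; ⊥-elim)
open import Data.Unit using (tt)
open import Data.Bool using (if_then_else_; T)
open import Relation.Nullary using (¬_; yes; no; does)
open import Relation.Nullary.Decidable using (dec-true; dec-false; from-yes; from-no; _→-dec_)
open import Relation.Binary.Structures using (IsStrictTotalOrder)
open import Relation.Binary.Definitions using (tri<; tri≈; tri>)
open import Relation.Binary.PropositionalEquality as ≡ using (_≡_)
open import Algebra.Solver.Ring.AlmostCommutativeRing using (_-Raw-AlmostCommutative⟶_; fromCommutativeRing)

-- The two values of Q₄ come from computing Q₁²Q₄ in two ways, which gives Q₂(Q₄ - 5) = 0. The
-- class-independence of the cubic form rests on positivity: a triple sum is an entry of a matrix
-- whose squared norm is a multiple of a vanishing Krein parameter. The same norm argument is then
-- reused with the vector Q₁(u,·)Q₄(y,·), which is not a column of any Qₖ, and this yields the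
-- fourfold sums. The cubic form itself stays unknown and has to cancel. On a class, Q₁ is the sign
-- times r shifted by -4 (own class) or +2 (other class), so the own class of u and a fourth class
-- give different expansions of one and the same number. The obstacle to integrality is that r is
-- only a field element. It is removed by cancelling it between the sums of one and of two signs, or
-- by squaring: 6 times a sum of signs is -r(s - 1), so s(s - 1)² is a perfect square and only s =
-- 1, 4, 9, 36 remain. Here s = 1 makes X empty, s = 4 and s = 9 make b₀* and b₁* zero, and s = 36
-- fails in a count modulo 4.

-- Arithmetic of the divisors of 36.

divisors-of-36 : ∀ {b} → b ∣ 36 → b ∈ 1 ∷ 2 ∷ 3 ∷ 4 ∷ 6 ∷ 9 ∷ 12 ∷ 18 ∷ 36 ∷ []
divisors-of-36 {b} b∣36 = ≡.subst (λ k → k ∣ 36 → k ∈ _) (toℕ-fromℕ< b<37)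
  (from-yes (all? {n = 37} (λ i → toℕ i ∣? 36 →-dec toℕ i ∈? (1 ∷ 2 ∷ 3 ∷ 4 ∷ 6 ∷ 9 ∷ 12 ∷ 18 ∷ 36 ∷ []))) (fromℕ< b<37)) b∣36
  where
  b<37 : b ℕ.< 37
  b<37 = ℕ.s≤s (∣⇒≤ b∣36)

between-squares : ∀ k {m a} → k ℕ.* k ℕ.< m → m ℕ.< suc k ℕ.* suc k → ¬ a ℕ.* a ≡ m
between-squares k {a = a} k²<m m<[1+k]² ≡.refl with a ℕ.≤? k
... | yes a≤k = ℕₚ.<⇒≱ k²<m (ℕₚ.*-mono-≤ a≤k a≤k)
... | no  a≰k = ℕₚ.<⇒≱ m<[1+k]² (ℕₚ.*-mono-≤ (ℕₚ.≰⇒> a≰k) (ℕₚ.≰⇒> a≰k))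

-- With b = r² the number b(b - 1)² is the square of r(b - 1), which turns out to be the integer -6
-- `S₁`. At 2, 3, 6, 12 and 18 it lies strictly between consecutive squares.
square-divisors-of-36 : ∀ b → b ∣ 36 → (∃ λ a → a ℕ.* a ≡ b ℕ.* (ℕ.pred b ℕ.* ℕ.pred b)) → b ∈ 1 ∷ 4 ∷ 9 ∷ 36 ∷ []
square-divisors-of-36 b b∣36 (a , a²≡) with divisors-of-36 b∣36
... | here ≡.refl = here ≡.refl
... | there (here ≡.refl) = ⊥-elim (between-squares 1 {a = a} (from-yes (1 ℕ.<? 2)) (from-yes (2 ℕ.<? 4)) a²≡)
... | there (there (here ≡.refl)) = ⊥-elim (between-squares 3 {a = a} (from-yes (9 ℕ.<? 12)) (from-yes (12 ℕ.<? 16)) a²≡)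
... | there (there (there (here ≡.refl))) = there (here ≡.refl)
... | there (there (there (there (here ≡.refl)))) = ⊥-elim (between-squares 12 {a = a} (from-yes (144 ℕ.<? 150)) (from-yes (150 ℕ.<? 169)) a²≡)
... | there (there (there (there (there (here ≡.refl))))) = there (there (here ≡.refl))
... | there (there (there (there (there (there (here ≡.refl)))))) = ⊥-elim (between-squares 38 {a = a} (from-yes (1444 ℕ.<? 1452)) (from-yes (1452 ℕ.<? 1521)) a²≡)
... | there (there (there (there (there (there (there (here ≡.refl))))))) = ⊥-elim (between-squares 72 {a = a} (from-yes (5184 ℕ.<? 5202)) (from-yes (5202 ℕ.<? 5329)) a²≡)
... | there (there (there (there (there (there (there (there (here ≡.refl)))))))) = there (there (there (here ≡.refl)))

-- The integers inside an ordered field, and the ring solver.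

module OrderedField {c ℓ₁ ℓ₂} (F : RealClosedField c ℓ₁ ℓ₂) where
  open RealClosedField F
  open import Relation.Binary.Reasoning.Setoid setoid
  open import Algebra.Properties.Ring ring using (-‿distribˡ-*; -‿distribʳ-*; -‿involutive; -‿+-comm; -0#≈0#)

  fromℕ-+ : ∀ m n → fromℕ (m ℕ.+ n) ≈ fromℕ m + fromℕ n
  fromℕ-+ zero    n = sym (+-identityˡ _)
  fromℕ-+ (suc m) n = trans (+-congˡ (fromℕ-+ m n)) (sym (+-assoc _ _ _))

  fromℕ-* : ∀ m n → fromℕ (m ℕ.* n) ≈ fromℕ m * fromℕ n
  fromℕ-* zero    n = sym (zeroˡ _)
  fromℕ-* (suc m) n = begin
    fromℕ (n ℕ.+ m ℕ.* n)              ≈⟨ fromℕ-+ n (m ℕ.* n) ⟩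
    fromℕ n + fromℕ (m ℕ.* n)          ≈⟨ +-cong (sym (*-identityˡ _)) (fromℕ-* m n) ⟩
    1# * fromℕ n + fromℕ m * fromℕ n   ≈⟨ distribʳ _ _ _ ⟨
    fromℕ (suc m) * fromℕ n            ∎

  ι : ℤ → Carrier
  ι (+ n)    = fromℕ n
  ι -[1+ n ] = - fromℕ (suc n)

  ι-⊖ : ∀ m n → ι (m ⊖ n) ≈ fromℕ m + - fromℕ n
  ι-⊖ m       zero    = sym (trans (+-congˡ -0#≈0#) (+-identityʳ _))
  ι-⊖ zero    (suc n) = sym (+-identityˡ _)
  ι-⊖ (suc m) (suc n) = begin
    ι (suc m ⊖ suc n)                        ≡⟨ ≡.cong ι (ℤₚ.[1+m]⊖[1+n]≡m⊖n m n) ⟩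
    ι (m ⊖ n)                                ≈⟨ ι-⊖ m n ⟩
    fromℕ m + - fromℕ n                      ≈⟨ +-congʳ (+-identityˡ _) ⟨
    0# + fromℕ m + - fromℕ n                 ≈⟨ +-congʳ (+-congʳ (-‿inverseʳ 1#)) ⟨
    1# + - 1# + fromℕ m + - fromℕ n          ≈⟨ +-congʳ (+-assoc _ _ _) ⟩
    1# + (- 1# + fromℕ m) + - fromℕ n        ≈⟨ +-congʳ (+-congˡ (+-comm _ _)) ⟩
    1# + (fromℕ m + - 1#) + - fromℕ n        ≈⟨ +-congʳ (sym (+-assoc _ _ _)) ⟩
    1# + fromℕ m + - 1# + - fromℕ n          ≈⟨ +-assoc _ _ _ ⟩
    1# + fromℕ m + (- 1# + - fromℕ n)        ≈⟨ +-congˡ (-‿+-comm _ _) ⟩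
    fromℕ (suc m) + - fromℕ (suc n)          ∎

  ι-+ : ∀ i j → ι (i ℤ.+ j) ≈ ι i + ι j
  ι-+ (+ m)    (+ n)    = fromℕ-+ m n
  ι-+ (+ m)    -[1+ n ] = ι-⊖ m (suc n)
  ι-+ -[1+ m ] (+ n)    = trans (ι-⊖ n (suc m)) (+-comm _ _)
  ι-+ -[1+ m ] -[1+ n ] = begin
    - fromℕ (suc (suc (m ℕ.+ n)))      ≡⟨ ≡.cong (λ k → - fromℕ (suc k)) (≡.sym (ℕₚ.+-suc m n)) ⟩
    - fromℕ (suc m ℕ.+ suc n)          ≈⟨ -‿cong (fromℕ-+ (suc m) (suc n)) ⟩
    - (fromℕ (suc m) + fromℕ (suc n))  ≈⟨ -‿+-comm _ _ ⟨
    - fromℕ (suc m) + - fromℕ (suc n)  ∎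

  ι-neg : ∀ i → ι (ℤ.- i) ≈ - ι i
  ι-neg (+ zero)  = sym -0#≈0#
  ι-neg (+ suc n) = refl
  ι-neg -[1+ n ]  = sym (-‿involutive _)

  ι-+◃ : ∀ n → ι (Sign.+ ◃ n) ≈ fromℕ n
  ι-+◃ zero    = refl
  ι-+◃ (suc n) = refl

  ι--◃ : ∀ n → ι (Sign.- ◃ n) ≈ - fromℕ n
  ι--◃ zero    = sym -0#≈0#
  ι--◃ (suc n) = refl

  ι-* : ∀ i j → ι (i ℤ.* j) ≈ ι i * ι j
  ι-* (+ m)    (+ n)    = trans (ι-+◃ (m ℕ.* n)) (fromℕ-* m n)
  ι-* (+ m)    -[1+ n ] = begin
    ι (Sign.- ◃ m ℕ.* suc n)    ≈⟨ ι--◃ (m ℕ.* suc n) ⟩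
    - fromℕ (m ℕ.* suc n)       ≈⟨ -‿cong (fromℕ-* m (suc n)) ⟩
    - (fromℕ m * fromℕ (suc n)) ≈⟨ -‿distribʳ-* _ _ ⟩
    fromℕ m * - fromℕ (suc n)   ∎
  ι-* -[1+ m ] (+ n)    = begin
    ι (Sign.- ◃ suc m ℕ.* n)    ≈⟨ ι--◃ (suc m ℕ.* n) ⟩
    - fromℕ (suc m ℕ.* n)       ≈⟨ -‿cong (fromℕ-* (suc m) n) ⟩
    - (fromℕ (suc m) * fromℕ n) ≈⟨ -‿distribˡ-* _ _ ⟩
    - fromℕ (suc m) * fromℕ n   ∎
  ι-* -[1+ m ] -[1+ n ] = begin
    fromℕ (suc m ℕ.* suc n)           ≈⟨ fromℕ-* (suc m) (suc n) ⟩
    fromℕ (suc m) * fromℕ (suc n)     ≈⟨ -‿involutive _ ⟨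
    - - (fromℕ (suc m) * fromℕ (suc n)) ≈⟨ -‿cong (-‿distribˡ-* _ _) ⟩
    - (- fromℕ (suc m) * fromℕ (suc n)) ≈⟨ -‿distribʳ-* _ _ ⟩
    - fromℕ (suc m) * - fromℕ (suc n) ∎

  -- Coefficients are computed in ℤ, so that `con (+ k)` evaluates to `fromℕ k`, the form in which
  -- numerals occur in the Krein array.
  ι-homomorphism : ℤ.+-*-rawRing -Raw-AlmostCommutative⟶ fromCommutativeRing commutativeRing
  ι-homomorphism = record
    { ⟦_⟧ = ι ; +-homo = ι-+ ; *-homo = ι-* ; -‿homo = ι-neg ; 0-homo = refl ; 1-homo = +-identityʳ 1# }

  ι-≟ : ∀ i j → Maybe (ι i ≈ ι j)
  ι-≟ i j with i ℤ.≟ j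
  ... | yes ≡.refl = just refl
  ... | no  _      = nothing

  open import Algebra.Solver.Ring ℤ.+-*-rawRing (fromCommutativeRing commutativeRing) ι-homomorphism ι-≟ public
    using (solve; _:=_; _:+_; _:*_; :-_; con)

  x-y≈0⇒x≈y : ∀ {x y} → x + - y ≈ 0# → x ≈ y
  x-y≈0⇒x≈y {x} {y} h = begin
    x                ≈⟨ +-identityʳ x ⟨
    x + 0#           ≈⟨ +-congˡ (-‿inverseˡ y) ⟨
    x + (- y + y)    ≈⟨ +-assoc _ _ _ ⟨
    (x + - y) + y    ≈⟨ +-congʳ h ⟩
    0# + y           ≈⟨ +-identityˡ y ⟩
    y                ∎

  x≈y⇒x-y≈0 : ∀ {x y} → x ≈ y → x + - y ≈ 0#
  x≈y⇒x-y≈0 {x} {y} h = trans (+-congʳ h) (-‿inverseʳ y)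

  x≈y⇒k[x-y]≈0 : ∀ k {x y} → x ≈ y → k * (x + - y) ≈ 0#
  x≈y⇒k[x-y]≈0 k h = trans (*-congˡ (x≈y⇒x-y≈0 h)) (zeroʳ k)

  -- An equation l ≈ r follows from hypotheses aᵢ ≈ bᵢ once l - r is a
  -- combination of the aᵢ - bᵢ, which the ring solver can check.
  combine₁ : ∀ {k a b l r} → a ≈ b → l + - r ≈ k * (a + - b) → l ≈ r
  combine₁ {k} h e = x-y≈0⇒x≈y (trans e (x≈y⇒k[x-y]≈0 k h))

  combine₂ : ∀ {k a b k′ a′ b′ l r} → a ≈ b → a′ ≈ b′ →
             l + - r ≈ k * (a + - b) + k′ * (a′ + - b′) → l ≈ r
  combine₂ {k} {k′ = k′} h h′ e = x-y≈0⇒x≈y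
    (trans e (trans (+-cong (x≈y⇒k[x-y]≈0 k h) (x≈y⇒k[x-y]≈0 k′ h′)) (+-identityˡ 0#)))

  combine₃ : ∀ {k a b k′ a′ b′ k″ a″ b″ l r} → a ≈ b → a′ ≈ b′ → a″ ≈ b″ →
             l + - r ≈ k * (a + - b) + k′ * (a′ + - b′) + k″ * (a″ + - b″) → l ≈ r
  combine₃ {k} {k′ = k′} {k″ = k″} h h′ h″ e = x-y≈0⇒x≈y
    (trans e (trans (+-cong (trans (+-cong (x≈y⇒k[x-y]≈0 k h) (x≈y⇒k[x-y]≈0 k′ h′)) (+-identityˡ 0#))
                            (x≈y⇒k[x-y]≈0 k″ h″)) (+-identityˡ 0#)))

  combine₄ : ∀ {k a b k′ a′ b′ k″ a″ b″ k‴ a‴ b‴ l r} → a ≈ b → a′ ≈ b′ → a″ ≈ b″ → a‴ ≈ b‴ →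
             l + - r ≈ k * (a + - b) + k′ * (a′ + - b′) + k″ * (a″ + - b″) + k‴ * (a‴ + - b‴) → l ≈ r
  combine₄ {k} {k′ = k′} {k″ = k″} {k‴ = k‴} h h′ h″ h‴ e = x-y≈0⇒x≈y
    (trans e (trans (+-cong (trans (+-cong (trans (+-cong (x≈y⇒k[x-y]≈0 k h) (x≈y⇒k[x-y]≈0 k′ h′)) (+-identityˡ 0#))
                            (x≈y⇒k[x-y]≈0 k″ h″)) (+-identityˡ 0#)) (x≈y⇒k[x-y]≈0 k‴ h‴)) (+-identityˡ 0#)))

  -- Positivity, cancellation and characteristic zero.

  open IsStrictTotalOrder isStrictTotalOrder public using (compare) renaming (_≟_ to _≈?_)
  open IsStrictTotalOrder isStrictTotalOrder using (irrefl; <-resp-≈) renaming (trans to <-trans)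

  private
    <-respʳ : ∀ {x y z} → y ≈ z → x < y → x < z
    <-respʳ = proj₁ <-resp-≈

    <-respˡ : ∀ {x y z} → y ≈ z → y < x → z < x
    <-respˡ = proj₂ <-resp-≈

  +-pos : ∀ {x y} → 0# < x → 0# < y → 0# < (x + y)
  +-pos {x} {y} 0<x 0<y = <-trans 0<y (<-respˡ (+-identityˡ y) (+-mono-< y 0<x))

  neg-pos : ∀ {x} → x < 0# → 0# < (- x)
  neg-pos {x} x<0 = <-respʳ (+-identityˡ _) (<-respˡ (-‿inverseʳ x) (+-mono-< (- x) x<0))

  pos⇒≉0 : ∀ {x} → 0# < x → ¬ x ≈ 0#
  pos⇒≉0 0<x x≈0 = irrefl (sym x≈0) 0<x

  xx>0 : ∀ {x} → ¬ x ≈ 0# → 0# < (x * x)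
  xx>0 {x} x≉0 with compare x 0#
  ... | tri≈ _ x≈0 _ = ⊥-elim (x≉0 x≈0)
  ... | tri> _ _ 0<x = *-pos 0<x 0<x
  ... | tri< x<0 _ _ = <-respʳ (solve 1 (λ x → (:- x) :* (:- x) := x :* x) refl x) (*-pos (neg-pos x<0) (neg-pos x<0))

  Nonneg : Carrier → Set _
  Nonneg x = x ≈ 0# ⊎ 0# < x

  xx≥0 : ∀ x → Nonneg (x * x)
  xx≥0 x with x ≈? 0#
  ... | yes x≈0 = inj₁ (trans (*-congʳ x≈0) (zeroˡ x))
  ... | no  x≉0 = inj₂ (xx>0 x≉0)

  +-nonneg : ∀ {x y} → Nonneg x → Nonneg y → Nonneg (x + y)
  +-nonneg (inj₁ x≈0) (inj₁ y≈0) = inj₁ (trans (+-cong x≈0 y≈0) (+-identityˡ 0#))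
  +-nonneg (inj₁ x≈0) (inj₂ 0<y) = inj₂ (<-respʳ (sym (trans (+-congʳ x≈0) (+-identityˡ _))) 0<y)
  +-nonneg (inj₂ 0<x) (inj₁ y≈0) = inj₂ (<-respʳ (sym (trans (+-congˡ y≈0) (+-identityʳ _))) 0<x)
  +-nonneg (inj₂ 0<x) (inj₂ 0<y) = inj₂ (+-pos 0<x 0<y)

  nonneg-cong : ∀ {x y} → x ≈ y → Nonneg x → Nonneg y
  nonneg-cong x≈y (inj₁ x≈0) = inj₁ (trans (sym x≈y) x≈0)
  nonneg-cong x≈y (inj₂ 0<x) = inj₂ (<-respʳ x≈y 0<x)

  nonneg-+≈0ˡ : ∀ {x y} → Nonneg x → Nonneg y → x + y ≈ 0# → x ≈ 0#
  nonneg-+≈0ˡ (inj₁ x≈0) _          _ = x≈0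
  nonneg-+≈0ˡ (inj₂ 0<x) (inj₁ y≈0) h = trans (sym (trans (+-congˡ y≈0) (+-identityʳ _))) h
  nonneg-+≈0ˡ (inj₂ 0<x) (inj₂ 0<y) h = ⊥-elim (pos⇒≉0 (+-pos 0<x 0<y) h)

  nonneg-neg⇒≈0 : ∀ {x} → Nonneg x → Nonneg (- x) → x ≈ 0#
  nonneg-neg⇒≈0 {x} p q = nonneg-+≈0ˡ p q (-‿inverseʳ x)

  xy≈0⇒y≈0 : ∀ {x y} → ¬ x ≈ 0# → x * y ≈ 0# → y ≈ 0#
  xy≈0⇒y≈0 {x} {y} x≉0 h with inverse x x≉0
  ... | x⁻¹ , xx⁻¹≈1 = begin
    y               ≈⟨ *-identityˡ y ⟨
    1# * y          ≈⟨ *-congʳ xx⁻¹≈1 ⟨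
    x * x⁻¹ * y     ≈⟨ solve 3 (λ x i y → x :* i :* y := i :* (x :* y)) refl x x⁻¹ y ⟩
    x⁻¹ * (x * y)   ≈⟨ *-congˡ h ⟩
    x⁻¹ * 0#        ≈⟨ zeroʳ _ ⟩
    0#              ∎

  xy≈0⇒x≈0⊎y≈0 : ∀ {x y} → x * y ≈ 0# → x ≈ 0# ⊎ y ≈ 0#
  xy≈0⇒x≈0⊎y≈0 {x} h with x ≈? 0#
  ... | yes x≈0 = inj₁ x≈0
  ... | no  x≉0 = inj₂ (xy≈0⇒y≈0 x≉0 h)

  *-cancel-≉0 : ∀ {k x y} → ¬ k ≈ 0# → k * x ≈ k * y → x ≈ y
  *-cancel-≉0 {k} {x} {y} k≉0 h = x-y≈0⇒x≈y (xy≈0⇒y≈0 k≉0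
    (trans (solve 3 (λ k x y → k :* (x :+ :- y) := k :* x :+ :- (k :* y)) refl k x y) (x≈y⇒x-y≈0 h)))

  xx≈yy⇒x≈±y : ∀ {x y} → x * x ≈ y * y → x ≈ y ⊎ x ≈ - y
  xx≈yy⇒x≈±y {x} {y} h with xy≈0⇒x≈0⊎y≈0 {x + - y} {x + y}
    (trans (solve 2 (λ x y → (x :+ :- y) :* (x :+ y) := x :* x :+ :- (y :* y)) refl x y) (x≈y⇒x-y≈0 h))
  ... | inj₁ e = inj₁ (x-y≈0⇒x≈y e)
  ... | inj₂ e = inj₂ (x-y≈0⇒x≈y (trans (+-congˡ (-‿involutive y)) e))

  fromℕ-pos : ∀ k → 0# < fromℕ (suc k)
  fromℕ-pos zero    = <-respʳ (sym (trans (+-identityʳ 1#) (sym (*-identityˡ 1#)))) (xx>0 nontrivial)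
  fromℕ-pos (suc k) = +-pos (<-respʳ (+-identityʳ 1#) (fromℕ-pos zero)) (fromℕ-pos k)

  fromℕ-≉0 : ∀ k → ¬ fromℕ (suc k) ≈ 0#
  fromℕ-≉0 k = pos⇒≉0 (fromℕ-pos k)

  fromℕ-nonneg : ∀ k → Nonneg (fromℕ k)
  fromℕ-nonneg zero    = inj₁ refl
  fromℕ-nonneg (suc k) = inj₂ (fromℕ-pos k)

  ι≈0⇒≡0 : ∀ i → ι i ≈ 0# → i ≡ + 0
  ι≈0⇒≡0 (+ zero)  _ = ≡.refl
  ι≈0⇒≡0 (+ suc k) h = ⊥-elim (fromℕ-≉0 k h)
  ι≈0⇒≡0 -[1+ k ]  h = ⊥-elim (fromℕ-≉0 k (trans (sym (-‿involutive _)) (trans (-‿cong h) -0#≈0#)))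

  ι-injective : ∀ {i j} → ι i ≈ ι j → i ≡ j
  ι-injective {i} {j} h = ℤₚ.i-j≡0⇒i≡j i j
    (ι≈0⇒≡0 (i ℤ.- j) (trans (ι-+ i (ℤ.- j)) (trans (+-congˡ (ι-neg j)) (x≈y⇒x-y≈0 h))))

  -- Integral elements of the field.

  IsInteger : Carrier → Set _
  IsInteger x = Σ ℤ λ k → x ≈ ι k

  integer-+ : ∀ {x y} → IsInteger x → IsInteger y → IsInteger (x + y)
  integer-+ (i , x≈) (j , y≈) = i ℤ.+ j , trans (+-cong x≈ y≈) (sym (ι-+ i j))

  integer-* : ∀ {x y} → IsInteger x → IsInteger y → IsInteger (x * y)
  integer-* (i , x≈) (j , y≈) = i ℤ.* j , trans (*-cong x≈ y≈) (sym (ι-* i j))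

  integer-neg : ∀ {x} → IsInteger x → IsInteger (- x)
  integer-neg (i , x≈) = ℤ.- i , trans (-‿cong x≈) (sym (ι-neg i))

  integer-fromℕ : ∀ k → IsInteger (fromℕ k)
  integer-fromℕ k = + k , refl

  integer-cong : ∀ {x y} → x ≈ y → IsInteger x → IsInteger y
  integer-cong x≈y (i , x≈) = i , trans (sym x≈y) x≈

  integer-≡ : ∀ {x y} (p : IsInteger x) (q : IsInteger y) → x ≈ y → proj₁ p ≡ proj₁ q
  integer-≡ (i , x≈) (j , y≈) x≈y = ι-injective (trans (sym x≈) (trans x≈y y≈))

  integer-∣ : ∀ k m {x} → IsInteger x → fromℕ k * x ≈ fromℕ m → k ∣ m
  integer-∣ k m p@(i , _) e = divides ∣ i ∣ (≡.trans
    (≡.cong ∣_∣ (≡.sym (integer-≡ (integer-* (integer-fromℕ k) p) (integer-fromℕ m) e)))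
    (≡.trans (ℤₚ.abs-* (+ k) i) (ℕₚ.*-comm k ∣ i ∣)))

  -- Writing y as the successor of b turns y - 1 into a natural number, so that taking absolute
  -- values leaves an equation in ℕ.
  integer-square : ∀ b {x y} → IsInteger x → y ≈ fromℕ (suc b) →
    x * x ≈ y * ((y + - fromℕ 1) * (y + - fromℕ 1)) → ∃ λ a → a ℕ.* a ≡ suc b ℕ.* (b ℕ.* b)
  integer-square b {x} {y} p@(i , _) y≈ x²≈ = ∣ i ∣ , ≡.trans (≡.sym (ℤₚ.abs-* i i))
    (≡.trans (≡.cong ∣_∣ (integer-≡ (integer-* p p) (integer-* q (integer-* q′ q′)) x²≈))
      (≡.trans (ℤₚ.abs-* (+ suc b) (+ b ℤ.* + b)) (≡.cong (suc b ℕ.*_) (ℤₚ.abs-* (+ b) (+ b)))))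
    where
    q : IsInteger y
    q = + suc b , y≈

    q′ : IsInteger (y + - fromℕ 1)
    q′ = + b , trans (+-congʳ y≈) (solve 2 (λ o b → o :+ b :+ :- (o :+ con (+ 0)) := b) refl 1# (fromℕ b))

  -- Finite sums.

  Σ-cong : ∀ {n} {f g : Fin n → Carrier} → (∀ i → f i ≈ g i) → Σ[< n ] f ≈ Σ[< n ] g
  Σ-cong {zero}  h = refl
  Σ-cong {suc n} h = +-cong (h zero) (Σ-cong (λ i → h (suc i)))

  Σ-0 : ∀ n → Σ[< n ] (λ _ → 0#) ≈ 0#
  Σ-0 zero    = refl
  Σ-0 (suc n) = trans (+-identityˡ _) (Σ-0 n)

  Σ-const : ∀ n k → Σ[< n ] (λ _ → k) ≈ fromℕ n * k
  Σ-const zero    k = sym (zeroˡ k)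
  Σ-const (suc n) k = trans (+-cong (sym (*-identityˡ k)) (Σ-const n k)) (sym (distribʳ k 1# (fromℕ n)))

  Σ-+ : ∀ {n} (f g : Fin n → Carrier) → Σ[< n ] (λ i → f i + g i) ≈ Σ[< n ] f + Σ[< n ] g
  Σ-+ {zero}  f g = sym (+-identityˡ 0#)
  Σ-+ {suc n} f g = trans (+-congˡ (Σ-+ (λ i → f (suc i)) (λ i → g (suc i))))
    (solve 4 (λ a b x y → a :+ b :+ (x :+ y) := a :+ x :+ (b :+ y)) refl _ _ _ _)

  Σ-*ˡ : ∀ {n} k (f : Fin n → Carrier) → Σ[< n ] (λ i → k * f i) ≈ k * Σ[< n ] f
  Σ-*ˡ {zero}  k f = sym (zeroʳ k)
  Σ-*ˡ {suc n} k f = trans (+-congˡ (Σ-*ˡ k (λ i → f (suc i)))) (sym (distribˡ k _ _))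

  Σ-*+ : ∀ {n} k (f g : Fin n → Carrier) → Σ[< n ] (λ i → k * f i + g i) ≈ k * Σ[< n ] f + Σ[< n ] g
  Σ-*+ k f g = trans (Σ-+ (λ i → k * f i) g) (+-congʳ (Σ-*ˡ k f))

  Σ-*ʳ : ∀ {n} k (f : Fin n → Carrier) → Σ[< n ] (λ i → f i * k) ≈ Σ[< n ] f * k
  Σ-*ʳ k f = trans (Σ-cong (λ i → *-comm (f i) k)) (trans (Σ-*ˡ k f) (*-comm k _))

  Σ-swap : ∀ {m n} (f : Fin m → Fin n → Carrier) →
           Σ[< m ] (λ i → Σ[< n ] (f i)) ≈ Σ[< n ] (λ j → Σ[< m ] (λ i → f i j))
  Σ-swap {zero}  {n} f = sym (Σ-0 n)
  Σ-swap {suc m} {n} f = trans (+-congˡ (Σ-swap (λ i → f (suc i))))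
    (sym (Σ-+ (f zero) (λ j → Σ[< m ] (λ i → f (suc i) j))))

  Σ-idM : ∀ {n} (u : Fin n) (f : Fin n → Carrier) → Σ[< n ] (λ z → idM F u z * f z) ≈ f u
  Σ-idM {suc n} zero    f = trans (+-cong (*-identityˡ _) (trans (Σ-cong {n} (λ z → zeroˡ _)) (Σ-0 n))) (+-identityʳ _)
  Σ-idM (suc u) f = trans (+-cong (zeroˡ _) (Σ-idM u (λ z → f (suc z)))) (+-identityˡ _)

  Σ-nonneg : ∀ {n} {f : Fin n → Carrier} → (∀ i → Nonneg (f i)) → Nonneg (Σ[< n ] f)
  Σ-nonneg {zero}  h = inj₁ refl
  Σ-nonneg {suc n} h = +-nonneg (h zero) (Σ-nonneg (λ i → h (suc i)))

  Σ-nonneg≈0 : ∀ {n} {f : Fin n → Carrier} → (∀ i → Nonneg (f i)) → Σ[< n ] f ≈ 0# → ∀ i → f i ≈ 0#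
  Σ-nonneg≈0 h e zero    = nonneg-+≈0ˡ (h zero) (Σ-nonneg (λ i → h (suc i))) e
  Σ-nonneg≈0 h e (suc i) = Σ-nonneg≈0 (λ i → h (suc i))
    (nonneg-+≈0ˡ (Σ-nonneg (λ i → h (suc i))) (h zero) (trans (+-comm _ _) e)) i

  Σ-squares≈0 : ∀ {n} (f : Fin n → Carrier) → Σ[< n ] (λ i → f i * f i) ≈ 0# → ∀ i → f i ≈ 0#
  Σ-squares≈0 f e i with xy≈0⇒x≈0⊎y≈0 (Σ-nonneg≈0 (λ i → xx≥0 (f i)) e i)
  ... | inj₁ z = z
  ... | inj₂ z = z

  Σ-integer : ∀ {n} {f : Fin n → Carrier} → (∀ i → IsInteger (f i)) → IsInteger (Σ[< n ] f)
  Σ-integer {zero}  h = integer-fromℕ 0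
  Σ-integer {suc n} h = integer-+ (h zero) (Σ-integer (λ i → h (suc i)))

  -- The constructive form of a counting argument: once the sum is known to be negative, the search
  -- must have produced a witness of P.
  Σ-find : ∀ {n p} {P : Fin n → Set p} {f : Fin n → Carrier} →
           (∀ i → P i ⊎ Nonneg (f i)) → ∃ P ⊎ Nonneg (Σ[< n ] f)
  Σ-find {zero}  h = inj₂ (inj₁ refl)
  Σ-find {suc n} h with h zero | Σ-find (λ i → h (suc i))
  ... | inj₁ p  | _              = inj₁ (zero , p)
  ... | inj₂ _  | inj₁ (i , p)   = inj₁ (suc i , p)
  ... | inj₂ f≥ | inj₂ Σ≥        = inj₂ (+-nonneg f≥ Σ≥)

-- Idempotents and Krein parameters of a general scheme.

module Scheme {c ℓ₁ ℓ₂} (F : RealClosedField c ℓ₁ ℓ₂) {n D : ℕ} (S : AssociationScheme n D)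
              (E : Fin (suc D) → Mat F n) (prim : IsPrimitiveIdempotents F S E)
              (q : Fin (suc D) → Fin (suc D) → Fin (suc D) → RealClosedField.Carrier F)
              (krein : IsKreinParameters F E q) where
  open RealClosedField F
  open OrderedField F
  open AssociationScheme S
  open IsPrimitiveIdempotents prim
  open import Relation.Binary.Reasoning.Setoid setoid

  x₀ : Fin n
  x₀ = proj₁ (nonempty zero)

  N : Carrier
  N = fromℕ n

  N≉0 : ¬ N ≈ 0#
  N≉0 = nonZero x₀
    where
    nonZero : ∀ {m} → Fin m → ¬ fromℕ m ≈ 0#
    nonZero {suc m} _ = fromℕ-≉0 m

  idM-diag : ∀ {m} (x : Fin m) → idM F x x ≈ 1#
  idM-diag x = reflexive (≡.cong (λ b → if b then 1# else 0#) (dec-true (x ≟ x) ≡.refl))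

  idM-off : ∀ {m} {x y : Fin m} → ¬ x ≡ y → idM F x y ≈ 0#
  idM-off {x = x} {y} x≢y = reflexive (≡.cong (λ b → if b then 1# else 0#) (dec-false (x ≟ y) x≢y))

  -- A member of the span of the adjacency matrices depends only on the relation containing (x, y);
  -- symmetry and constant diagonal follow.
  E-rel : ∀ i → Σ (Fin (suc D) → Carrier) λ e → ∀ x y → E i x y ≈ e (rel x y)
  E-rel i = (λ t → Σ[< suc D ] (λ j → proj₁ (in-algebra i) j * (if does (t ≟ j) then 1# else 0#))) ,
            proj₂ (in-algebra i)

  -- The entry is the dual eigenvalue of `E i` at the relation of x and y. The factor N removes the
  -- denominator |X| from the Krein relations and makes the diagonal entry the multiplicity mᵢ.
  Q : Fin (suc D) → Fin n → Fin n → Carrier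
  Q i x y = N * E i x y

  Q-sym : ∀ i x y → Q i x y ≈ Q i y x
  Q-sym i x y with E-rel i
  ... | e , E≈e = *-congˡ (trans (E≈e x y) (trans (reflexive (≡.cong e (rel-sym x y))) (sym (E≈e y x))))

  Q-diag : ∀ i x y → Q i x x ≈ Q i y y
  Q-diag i x y with E-rel i
  ... | e , E≈e = *-congˡ (trans (E≈e x x) (trans (reflexive (≡.cong e
    (≡.trans (proj₂ (rel-diag x x) ≡.refl) (≡.sym (proj₂ (rel-diag y y) ≡.refl))))) (sym (E≈e y y))))

  Q-convolution : ∀ i j x y → Σ[< n ] (λ z → Q i x z * Q j y z) ≈ N * N * Σ[< n ] (λ z → E i x z * E j z y)
  Q-convolution i j x y = trans
    (Σ-cong {n} λ z → trans (*-congˡ (Q-sym j y z))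
      (solve 3 (λ N a b → N :* a :* (N :* b) := N :* N :* (a :* b)) refl N (E i x z) (E j z y)))
    (Σ-*ˡ (N * N) (λ z → E i x z * E j z y))

  Q-orthogonal : ∀ {i j} → ¬ i ≡ j → ∀ x y → Σ[< n ] (λ z → Q i x z * Q j y z) ≈ 0#
  Q-orthogonal {i} {j} i≢j x y = trans (Q-convolution i j x y)
    (trans (*-congˡ (proj₂ (orthogonal-idempotent i j) i≢j x y)) (zeroʳ _))

  Q-idempotent : ∀ i x y → Σ[< n ] (λ z → Q i x z * Q i y z) ≈ N * Q i x y
  Q-idempotent i x y = trans (Q-convolution i i x y)
    (trans (*-congˡ (proj₁ (orthogonal-idempotent i i) ≡.refl x y)) (*-assoc _ _ _))

  Q-Krein : ∀ i j x y → Q i x y * Q j x y ≈ Σ[< suc D ] (λ k → q i j k * Q k x y)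
  Q-Krein i j x y = begin
    N * E i x y * (N * E j x y)               ≈⟨ solve 3 (λ N a b → N :* a :* (N :* b) := N :* (N :* (a :* b))) refl N (E i x y) (E j x y) ⟩
    N * (N * (E i x y * E j x y))             ≈⟨ *-congˡ (krein i j x y) ⟩
    N * Σ[< suc D ] (λ k → q i j k * E k x y) ≈⟨ Σ-*ˡ N (λ k → q i j k * E k x y) ⟨
    Σ[< suc D ] (λ k → N * (q i j k * E k x y)) ≈⟨ Σ-cong {suc D} (λ k → solve 3 (λ N a b → N :* (a :* b) := a :* (N :* b)) refl N (q i j k) (E k x y)) ⟩
    Σ[< suc D ] (λ k → q i j k * Q k x y)     ∎

  Q₀≈1 : ∀ x y → Q zero x y ≈ 1#
  Q₀≈1 = E₀

  Σ-Q≈N·I : ∀ x y → Σ[< suc D ] (λ i → Q i x y) ≈ N * idM F x y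
  Σ-Q≈N·I x y = trans (Σ-*ˡ N (λ i → E i x y)) (*-congˡ (complete x y))

  row-sum : ∀ {i} → ¬ i ≡ zero → ∀ x → Σ[< n ] (λ z → Q i x z) ≈ 0#
  row-sum {i} i≢0 x = trans
    (Σ-cong {n} λ z → sym (trans (*-congˡ (Q₀≈1 x z)) (*-identityʳ _)))
    (Q-orthogonal i≢0 x x)

  -- Multiplying the relation by `Q l` as matrices kills every term but the l-th, leaving a l · N ·
  -- `Q l`, and `E l` is nonzero.
  Q-independent : ∀ (a : Fin (suc D) → Carrier) →
                  (∀ x y → Σ[< suc D ] (λ k → a k * Q k x y) ≈ 0#) → ∀ l → a l ≈ 0#
  Q-independent a Σaq≈0 l with a l ≈? 0#
  ... | yes a≈0 = a≈0
  ... | no  a≉0 = ⊥-elim (nonzero l λ x y → xy≈0⇒y≈0 N≉0 (xy≈0⇒y≈0 N≉0 (xy≈0⇒y≈0 a≉0 (begin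
    a l * (N * Q l x y)                                               ≈⟨ Σ-idM l (λ k → a k * (N * Q k x y)) ⟨
    Σ[< suc D ] (λ k → idM F l k * (a k * (N * Q k x y)))             ≈⟨ Σ-cong {suc D} (λ k → pick x y k) ⟨
    Σ[< suc D ] (λ k → a k * Σ[< n ] (λ z → Q k x z * Q l y z))       ≈⟨ Σ-cong {suc D} (λ k → Σ-*ˡ (a k) (λ z → Q k x z * Q l y z)) ⟨
    Σ[< suc D ] (λ k → Σ[< n ] (λ z → a k * (Q k x z * Q l y z)))     ≈⟨ Σ-swap (λ k z → a k * (Q k x z * Q l y z)) ⟩
    Σ[< n ] (λ z → Σ[< suc D ] (λ k → a k * (Q k x z * Q l y z)))     ≈⟨ Σ-cong {n} (λ z → trans (Σ-cong {suc D} (λ k → sym (*-assoc (a k) (Q k x z) (Q l y z)))) (Σ-*ʳ (Q l y z) (λ k → a k * Q k x z))) ⟩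
    Σ[< n ] (λ z → Σ[< suc D ] (λ k → a k * Q k x z) * Q l y z)       ≈⟨ Σ-cong {n} (λ z → trans (*-congʳ (Σaq≈0 x z)) (zeroˡ _)) ⟩
    Σ[< n ] (λ z → 0#)                                                ≈⟨ Σ-0 n ⟩
    0#                                                                ∎))))
    where
    pick : ∀ x y k → a k * Σ[< n ] (λ z → Q k x z * Q l y z) ≈ idM F l k * (a k * (N * Q k x y))
    pick x y k with l ≟ k
    ... | yes ≡.refl = trans (*-congˡ (Q-idempotent l x y)) (sym (*-identityˡ _))
    ... | no  l≢k    = trans (trans (*-congˡ (Q-orthogonal (λ e → l≢k (≡.sym e)) x y)) (zeroʳ _)) (sym (zeroˡ _))

  -- Entrywise, Qᵢ times Σⱼ Qⱼ = N·I is mᵢ N·I = mᵢ Σₖ Qₖ; compare coefficients of the Qₖ. This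
  -- determines the diagonal Krein parameters, which the Krein array leaves implicit.
  Σⱼqᵢⱼᵏ≈mᵢ : ∀ i k → Σ[< suc D ] (λ j → q i j k) ≈ Q i x₀ x₀
  Σⱼqᵢⱼᵏ≈mᵢ i k = x-y≈0⇒x≈y (Q-independent (λ k → Σ[< suc D ] (λ j → q i j k) + - m) vanish k)
    where
    m : Carrier
    m = Q i x₀ x₀

    Qᵢ·I : ∀ x y → Q i x y * (N * idM F x y) ≈ m * (N * idM F x y)
    Qᵢ·I x y with x ≟ y
    ... | yes ≡.refl = *-congʳ (Q-diag i x x₀)
    ... | no  _      = trans (trans (*-congˡ (zeroʳ N)) (zeroʳ _)) (sym (trans (*-congˡ (zeroʳ N)) (zeroʳ _)))

    vanish : ∀ x y → Σ[< suc D ] (λ k → (Σ[< suc D ] (λ j → q i j k) + - m) * Q k x y) ≈ 0#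
    vanish x y = begin
      Σ[< suc D ] (λ k → (Σ[< suc D ] (λ j → q i j k) + - m) * Q k x y)
        ≈⟨ Σ-cong {suc D} (λ k → trans (distribʳ (Q k x y) _ (- m)) (+-congʳ (sym (Σ-*ʳ (Q k x y) (λ j → q i j k))))) ⟩
      Σ[< suc D ] (λ k → Σ[< suc D ] (λ j → q i j k * Q k x y) + - m * Q k x y)
        ≈⟨ Σ-+ (λ k → Σ[< suc D ] (λ j → q i j k * Q k x y)) (λ k → - m * Q k x y) ⟩
      Σ[< suc D ] (λ k → Σ[< suc D ] (λ j → q i j k * Q k x y)) + Σ[< suc D ] (λ k → - m * Q k x y)
        ≈⟨ +-cong (Σ-swap (λ k j → q i j k * Q k x y)) (Σ-*ˡ (- m) (λ k → Q k x y)) ⟩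
      Σ[< suc D ] (λ j → Σ[< suc D ] (λ k → q i j k * Q k x y)) + - m * Σ[< suc D ] (λ k → Q k x y)
        ≈⟨ +-cong (Σ-cong {suc D} (λ j → sym (Q-Krein i j x y))) (*-congˡ (Σ-Q≈N·I x y)) ⟩
      Σ[< suc D ] (λ j → Q i x y * Q j x y) + - m * (N * idM F x y)
        ≈⟨ +-congʳ (trans (Σ-*ˡ (Q i x y) (λ j → Q j x y)) (trans (*-congˡ (Σ-Q≈N·I x y)) (Qᵢ·I x y))) ⟩
      m * (N * idM F x y) + - m * (N * idM F x y)
        ≈⟨ solve 2 (λ m a → m :* a :+ (:- m) :* a := con (+ 0)) refl m _ ⟩
      0# ∎

  -- Since Q₀ is constantly 1, Qᵢ ∘ Q₀ = Qᵢ. For i = 1 this is a diagonal entry of the tridiagonal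
  -- matrix, on which the Q-polynomial property is silent.
  qᵢ₀⁰≈0 : ∀ {i} → ¬ i ≡ zero → q i zero zero ≈ 0#
  qᵢ₀⁰≈0 {i} i≢0 = trans (sym (trans (+-congˡ (trans (-‿cong (idM-off i≢0)) -0≈0)) (+-identityʳ _)))
    (Q-independent (λ k → q i zero k + - idM F i k) vanish zero)
    where
    -0≈0 : - 0# ≈ 0#
    -0≈0 = solve 0 (:- con (+ 0) := con (+ 0)) refl

    vanish : ∀ x y → Σ[< suc D ] (λ k → (q i zero k + - idM F i k) * Q k x y) ≈ 0#
    vanish x y = begin
      Σ[< suc D ] (λ k → (q i zero k + - idM F i k) * Q k x y)
        ≈⟨ Σ-cong {suc D} (λ k → solve 3 (λ a e Q → (a :+ :- e) :* Q := a :* Q :+ e :* (:- Q)) refl (q i zero k) (idM F i k) (Q k x y)) ⟩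
      Σ[< suc D ] (λ k → q i zero k * Q k x y + idM F i k * - Q k x y)
        ≈⟨ Σ-+ (λ k → q i zero k * Q k x y) (λ k → idM F i k * - Q k x y) ⟩
      Σ[< suc D ] (λ k → q i zero k * Q k x y) + Σ[< suc D ] (λ k → idM F i k * - Q k x y)
        ≈⟨ +-cong (sym (Q-Krein i zero x y)) (Σ-idM i (λ k → - Q k x y)) ⟩
      Q i x y * Q zero x y + - Q i x y
        ≈⟨ +-congʳ (trans (*-congˡ (Q₀≈1 x y)) (*-identityʳ _)) ⟩
      Q i x y + - Q i x y
        ≈⟨ -‿inverseʳ _ ⟩
      0# ∎

  -- Norms and triple sums.

  Σ-product : ∀ {m m′} (f : Fin m → Carrier) (g : Fin m′ → Carrier) →
              Σ[< m ] f * Σ[< m′ ] g ≈ Σ[< m ] (λ z → Σ[< m′ ] (λ z′ → f z * g z′))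
  Σ-product {m} f g = trans (sym (Σ-*ʳ _ f)) (Σ-cong {m} (λ z → sym (Σ-*ˡ (f z) g)))

  Σ-rotate : ∀ {m} (f : Fin m → Fin n → Fin n → Carrier) →
             Σ[< m ] (λ v → Σ[< n ] (λ z → Σ[< n ] (f v z))) ≈
             Σ[< n ] (λ z → Σ[< n ] (λ z′ → Σ[< m ] (λ v → f v z z′)))
  Σ-rotate f = trans (Σ-swap (λ v z → Σ[< n ] (f v z))) (Σ-cong {n} (λ z → Σ-swap (λ v z′ → f v z z′)))

  -- `Q j` is symmetric with matrix square N · `Q j`, so the squared norm of its image of a is a
  -- quadratic form in a.
  norm-projection : ∀ j (a : Fin n → Carrier) →
    Σ[< n ] (λ v → Σ[< n ] (λ z → a z * Q j v z) * Σ[< n ] (λ z → a z * Q j v z)) ≈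
    Σ[< n ] (λ z → Σ[< n ] (λ z′ → a z * a z′ * (N * Q j z z′)))
  norm-projection j a = begin
    Σ[< n ] (λ v → Σ[< n ] (λ z → a z * Q j v z) * Σ[< n ] (λ z → a z * Q j v z))
      ≈⟨ Σ-cong {n} (λ v → Σ-product (λ z → a z * Q j v z) (λ z → a z * Q j v z)) ⟩
    Σ[< n ] (λ v → Σ[< n ] (λ z → Σ[< n ] (λ z′ → a z * Q j v z * (a z′ * Q j v z′))))
      ≈⟨ Σ-rotate (λ v z z′ → a z * Q j v z * (a z′ * Q j v z′)) ⟩
    Σ[< n ] (λ z → Σ[< n ] (λ z′ → Σ[< n ] (λ v → a z * Q j v z * (a z′ * Q j v z′))))
      ≈⟨ Σ-cong {n} (λ z → Σ-cong {n} (λ z′ → trans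
           (Σ-cong {n} (λ v → trans (*-cong (*-congˡ (Q-sym j v z)) (*-congˡ (Q-sym j v z′)))
             (solve 4 (λ a b x y → a :* x :* (b :* y) := a :* b :* (x :* y)) refl (a z) (a z′) (Q j z v) (Q j z′ v))))
           (trans (Σ-*ˡ (a z * a z′) (λ v → Q j z v * Q j z′ v)) (*-congˡ (Q-idempotent j z z′))))) ⟩
    Σ[< n ] (λ z → Σ[< n ] (λ z′ → a z * a z′ * (N * Q j z z′))) ∎

  -- For d a column of Q k this says that the triple product sums of Q i, Q j, Q k
  -- vanish when the Krein parameter does: their squares add up to a multiple of it.
  triple-sum-vanishes : ∀ i j (d : Fin n → Carrier) →
    (∀ z → Σ[< n ] (λ z′ → Q i z z′ * Q j z z′ * d z′) ≈ 0#) →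
    ∀ u v → Σ[< n ] (λ z → Q i u z * Q j v z * d z) ≈ 0#
  triple-sum-vanishes i j d h u v = trans
    (Σ-cong {n} (λ z → solve 3 (λ a b d → a :* b :* d := a :* d :* b) refl (Q i u z) (Q j v z) (d z)))
    (Σ-squares≈0 (M u) (Σ-nonneg≈0 (λ u → Σ-nonneg {n} (λ v → xx≥0 (M u v))) total u) v)
    where
    M : Fin n → Fin n → Carrier
    M u v = Σ[< n ] (λ z → Q i u z * d z * Q j v z)

    total : Σ[< n ] (λ u → Σ[< n ] (λ v → M u v * M u v)) ≈ 0#
    total = begin
      Σ[< n ] (λ u → Σ[< n ] (λ v → M u v * M u v))
        ≈⟨ Σ-cong {n} (λ u → norm-projection j (λ z → Q i u z * d z)) ⟩
      Σ[< n ] (λ u → Σ[< n ] (λ z → Σ[< n ] (λ z′ → Q i u z * d z * (Q i u z′ * d z′) * (N * Q j z z′))))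
        ≈⟨ Σ-rotate (λ u z z′ → Q i u z * d z * (Q i u z′ * d z′) * (N * Q j z z′)) ⟩
      Σ[< n ] (λ z → Σ[< n ] (λ z′ → Σ[< n ] (λ u → Q i u z * d z * (Q i u z′ * d z′) * (N * Q j z z′))))
        ≈⟨ Σ-cong {n} (λ z → Σ-cong {n} (λ z′ → trans
             (Σ-cong {n} (λ u → trans (*-congʳ (*-cong (*-congʳ (Q-sym i u z)) (*-congʳ (Q-sym i u z′))))
               (solve 5 (λ x y d e t → x :* d :* (y :* e) :* t := d :* e :* t :* (x :* y)) refl
                 (Q i z u) (Q i z′ u) (d z) (d z′) (N * Q j z z′))))
             (trans (Σ-*ˡ (d z * d z′ * (N * Q j z z′)) (λ u → Q i z u * Q i z′ u))
               (trans (*-congˡ (Q-idempotent i z z′))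
                 (solve 5 (λ d e N a b → d :* e :* (N :* b) :* (N :* a) := d :* N :* N :* (a :* b :* e)) refl
                   (d z) (d z′) N (Q i z z′) (Q j z z′)))))) ⟩
      Σ[< n ] (λ z → Σ[< n ] (λ z′ → d z * N * N * (Q i z z′ * Q j z z′ * d z′)))
        ≈⟨ Σ-cong {n} (λ z → trans (Σ-*ˡ (d z * N * N) (λ z′ → Q i z z′ * Q j z z′ * d z′))
             (trans (*-congˡ (h z)) (zeroʳ _))) ⟩
      Σ[< n ] (λ z → 0#)
        ≈⟨ Σ-0 n ⟩
      0# ∎

-- The given Krein array: Krein parameters and entrywise products.

module _ {c ℓ₁ ℓ₂} (F : RealClosedField c ℓ₁ ℓ₂) where
  open RealClosedField F

  module KreinArray
    (r : Carrier) (r>0 : 0# < r) {n : ℕ} (S : AssociationScheme n 4)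
    (E : Fin 5 → Mat F n) (prim : IsPrimitiveIdempotents F S E)
    (q : Fin 5 → Fin 5 → Fin 5 → Carrier)
    (krein : IsKreinParameters F E q) (qpoly : IsQPolynomial F q)
    (b₀ : bStar F q 0F ≈ r * r + - fromℕ 4) (b₁ : bStar F q 1F ≈ r * r + - fromℕ 9)
    (b₂ : bStar F q 2F ≈ fromℕ 10) (b₃ : bStar F q 3F ≈ fromℕ 1)
    (c₁ : cStar F q 0F ≈ fromℕ 1) (c₂ : cStar F q 1F ≈ fromℕ 2)
    (c₃ : cStar F q 2F ≈ r * r + - fromℕ 9) (c₄ : cStar F q 3F ≈ r * r + - fromℕ 4) where
    open OrderedField F
    open Scheme F S E prim q krein
    open import Relation.Binary.Reasoning.Setoid setoid

    s : Carrier
    s = r * r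

    s-4≉0 : ¬ s + - fromℕ 4 ≈ 0#
    s-4≉0 h = proj₂ (qpoly 1F 0F) (inj₂ ≡.refl) (trans b₀ h)

    s-9≉0 : ¬ s + - fromℕ 9 ≈ 0#
    s-9≉0 h = proj₂ (qpoly 2F 1F) (inj₂ ≡.refl) (trans b₁ h)

    q-far> : ∀ j k → T (suc (toℕ k) ℕ.<ᵇ toℕ j) → q 1F j k ≈ 0#
    q-far> j k p = proj₁ (qpoly j k) (inj₂ (ℕₚ.<ᵇ⇒< (suc (toℕ k)) (toℕ j) p))

    q-far< : ∀ j k → T (suc (toℕ j) ℕ.<ᵇ toℕ k) → q 1F j k ≈ 0#
    q-far< j k p = proj₁ (qpoly j k) (inj₁ (ℕₚ.<ᵇ⇒< (suc (toℕ j)) (toℕ k) p))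

    sum₅-cong : ∀ {a₀ a₁ a₂ a₃ a₄ b₀ b₁ b₂ b₃ b₄} → a₀ ≈ b₀ → a₁ ≈ b₁ → a₂ ≈ b₂ → a₃ ≈ b₃ → a₄ ≈ b₄ →
                a₀ + (a₁ + (a₂ + (a₃ + (a₄ + 0#)))) ≈ b₀ + (b₁ + (b₂ + (b₃ + (b₄ + 0#))))
    sum₅-cong h₀ h₁ h₂ h₃ h₄ = +-cong h₀ (+-cong h₁ (+-cong h₂ (+-cong h₃ (+-congʳ h₄))))

    m₁ : Q 1F x₀ x₀ ≈ s + - fromℕ 4
    m₁ = begin
      Q 1F x₀ x₀ ≈⟨ Σⱼqᵢⱼᵏ≈mᵢ 1F 0F ⟨
      _          ≈⟨ sum₅-cong (qᵢ₀⁰≈0 (λ ())) b₀ (q-far> 2F 0F tt) (q-far> 3F 0F tt) (q-far> 4F 0F tt) ⟩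
      _          ≈⟨ solve 1 (λ b → con (+ 0) :+ (b :+ (con (+ 0) :+ (con (+ 0) :+ (con (+ 0) :+ con (+ 0))))) := b) refl (s + - fromℕ 4) ⟩
      s + - fromℕ 4 ∎

    -- The parameters q₁ⱼᵏ with k fixed sum to m₁ = s - 4, so the diagonal one is m₁ - bₖ* - cₖ*.
    -- For k = 1, 2, 3, 4 this is 4, s - 16, 4, 0.
    a₁ : q 1F 1F 1F ≈ fromℕ 4
    a₁ = combine₁ (trans (sym (sum₅-cong c₁ (refl {q 1F 1F 1F}) b₁ (q-far> 3F 1F tt) (q-far> 4F 1F tt)))
                         (trans (Σⱼqᵢⱼᵏ≈mᵢ 1F 1F) m₁))
      (solve 2 (λ a s → a :+ :- con (+ 4) := con (+ 1) :* ((con (+ 1) :+ (a :+ ((s :+ :- con (+ 9)) :+ (con (+ 0) :+ (con (+ 0) :+ con (+ 0))))))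
                 :+ :- (s :+ :- con (+ 4)))) refl (q 1F 1F 1F) s)

    a₂ : q 1F 2F 2F ≈ s + - fromℕ 16
    a₂ = combine₁ (trans (sym (sum₅-cong (q-far< 0F 2F tt) c₂ (refl {q 1F 2F 2F}) b₂ (q-far> 4F 2F tt)))
                         (trans (Σⱼqᵢⱼᵏ≈mᵢ 1F 2F) m₁))
      (solve 2 (λ a s → a :+ :- (s :+ :- con (+ 16)) := con (+ 1) :* ((con (+ 0) :+ (con (+ 2) :+ (a :+ (con (+ 10) :+ (con (+ 0) :+ con (+ 0))))))
                 :+ :- (s :+ :- con (+ 4)))) refl (q 1F 2F 2F) s)

    a₃ : q 1F 3F 3F ≈ fromℕ 4
    a₃ = combine₁ (trans (sym (sum₅-cong (q-far< 0F 3F tt) (q-far< 1F 3F tt) c₃ (refl {q 1F 3F 3F}) b₃))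
                         (trans (Σⱼqᵢⱼᵏ≈mᵢ 1F 3F) m₁))
      (solve 2 (λ a s → a :+ :- con (+ 4) := con (+ 1) :* ((con (+ 0) :+ (con (+ 0) :+ ((s :+ :- con (+ 9)) :+ (a :+ (con (+ 1) :+ con (+ 0))))))
                 :+ :- (s :+ :- con (+ 4)))) refl (q 1F 3F 3F) s)

    a₄ : q 1F 4F 4F ≈ 0#
    a₄ = combine₁ (trans (sym (sum₅-cong (q-far< 0F 4F tt) (q-far< 1F 4F tt) (q-far< 2F 4F tt) c₄ (refl {q 1F 4F 4F})))
                         (trans (Σⱼqᵢⱼᵏ≈mᵢ 1F 4F) m₁))
      (solve 2 (λ a s → a :+ :- con (+ 0) := con (+ 1) :* ((con (+ 0) :+ (con (+ 0) :+ (con (+ 0) :+ ((s :+ :- con (+ 4)) :+ (a :+ con (+ 0))))))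
                 :+ :- (s :+ :- con (+ 4)))) refl (q 1F 4F 4F) s)

    -- In the solver `con (+ 1)` evaluates to `fromℕ 1`, that is `1# + 0#`, so the entry is restated
    -- in that form.
    Q₀≈fromℕ1 : ∀ x y → Q 0F x y ≈ fromℕ 1
    Q₀≈fromℕ1 x y = trans (Q₀≈1 x y) (sym (+-identityʳ 1#))

    Q₁Q₁ : ∀ x y → Q 1F x y * Q 1F x y ≈ (s + - fromℕ 4) + fromℕ 4 * Q 1F x y + fromℕ 2 * Q 2F x y
    Q₁Q₁ x y = trans (Q-Krein 1F 1F x y) (trans
      (sum₅-cong (*-cong b₀ (Q₀≈fromℕ1 x y)) (*-congʳ a₁) (*-congʳ c₂) (*-congʳ (q-far< 1F 3F tt)) (*-congʳ (q-far< 1F 4F tt)))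
      (solve 5 (λ s t Q₂ Q₃ Q₄ → (s :+ :- con (+ 4)) :* con (+ 1) :+ (con (+ 4) :* t :+ (con (+ 2) :* Q₂ :+ (con (+ 0) :* Q₃ :+ (con (+ 0) :* Q₄ :+ con (+ 0)))))
         := (s :+ :- con (+ 4)) :+ con (+ 4) :* t :+ con (+ 2) :* Q₂) refl s (Q 1F x y) (Q 2F x y) (Q 3F x y) (Q 4F x y)))

    Q₁Q₂ : ∀ x y → Q 1F x y * Q 2F x y ≈
           (s + - fromℕ 9) * Q 1F x y + (s + - fromℕ 16) * Q 2F x y + (s + - fromℕ 9) * Q 3F x y
    Q₁Q₂ x y = trans (Q-Krein 1F 2F x y) (trans
      (sum₅-cong (*-cong (q-far> 2F 0F tt) (Q₀≈fromℕ1 x y)) (*-congʳ b₁) (*-congʳ a₂) (*-congʳ c₃) (*-congʳ (q-far< 2F 4F tt)))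
      (solve 5 (λ s t Q₂ Q₃ Q₄ → con (+ 0) :* con (+ 1) :+ ((s :+ :- con (+ 9)) :* t :+ ((s :+ :- con (+ 16)) :* Q₂ :+ ((s :+ :- con (+ 9)) :* Q₃ :+ (con (+ 0) :* Q₄ :+ con (+ 0)))))
         := (s :+ :- con (+ 9)) :* t :+ (s :+ :- con (+ 16)) :* Q₂ :+ (s :+ :- con (+ 9)) :* Q₃) refl s (Q 1F x y) (Q 2F x y) (Q 3F x y) (Q 4F x y)))

    Q₁Q₃ : ∀ x y → Q 1F x y * Q 3F x y ≈ fromℕ 10 * Q 2F x y + fromℕ 4 * Q 3F x y + (s + - fromℕ 4) * Q 4F x y
    Q₁Q₃ x y = trans (Q-Krein 1F 3F x y) (trans
      (sum₅-cong (*-cong (q-far> 3F 0F tt) (Q₀≈fromℕ1 x y)) (*-congʳ (q-far> 3F 1F tt)) (*-congʳ b₂) (*-congʳ a₃) (*-congʳ c₄))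
      (solve 5 (λ s t Q₂ Q₃ Q₄ → con (+ 0) :* con (+ 1) :+ (con (+ 0) :* t :+ (con (+ 10) :* Q₂ :+ (con (+ 4) :* Q₃ :+ ((s :+ :- con (+ 4)) :* Q₄ :+ con (+ 0)))))
         := con (+ 10) :* Q₂ :+ con (+ 4) :* Q₃ :+ (s :+ :- con (+ 4)) :* Q₄) refl s (Q 1F x y) (Q 2F x y) (Q 3F x y) (Q 4F x y)))

    Q₁Q₄ : ∀ x y → Q 1F x y * Q 4F x y ≈ Q 3F x y
    Q₁Q₄ x y = trans (Q-Krein 1F 4F x y) (trans
      (sum₅-cong (*-cong (q-far> 4F 0F tt) (Q₀≈fromℕ1 x y)) (*-congʳ (q-far> 4F 1F tt)) (*-congʳ (q-far> 4F 2F tt)) (*-congʳ b₃) (*-congʳ a₄))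
      (solve 4 (λ t Q₂ Q₃ Q₄ → con (+ 0) :* con (+ 1) :+ (con (+ 0) :* t :+ (con (+ 0) :* Q₂ :+ (con (+ 1) :* Q₃ :+ (con (+ 0) :* Q₄ :+ con (+ 0)))))
         := Q₃) refl (Q 1F x y) (Q 2F x y) (Q 3F x y) (Q 4F x y)))

    Q₁-diag : ∀ x → Q 1F x x ≈ s + - fromℕ 4
    Q₁-diag x = trans (Q-diag 1F x x₀) m₁

    -- The values of Q₄ and the number of points.

    -- Q₁²Q₄ equals ((s - 4) + 4Q₁ + 2Q₂)Q₄ and also Q₁Q₃ = 10Q₂ + 4Q₃ + (s - 4)Q₄. As Q₁Q₄ = Q₃,
    -- the difference is 2Q₂(Q₄ - 5).
    Q₂[Q₄-5]≈0 : ∀ x y → Q 2F x y * (Q 4F x y + - fromℕ 5) ≈ 0#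
    Q₂[Q₄-5]≈0 x y = xy≈0⇒y≈0 (fromℕ-≉0 1) (combine₃ (Q₁Q₁ x y) (Q₁Q₄ x y) (Q₁Q₃ x y)
      (solve 5 (λ s t Q₂ Q₃ Q₄ → con (+ 2) :* (Q₂ :* (Q₄ :+ :- con (+ 5))) :+ :- con (+ 0) :=
          (:- Q₄) :* (t :* t :+ :- ((s :+ :- con (+ 4)) :+ con (+ 4) :* t :+ con (+ 2) :* Q₂))
          :+ (t :+ :- con (+ 4)) :* (t :* Q₄ :+ :- Q₃)
          :+ con (+ 1) :* (t :* Q₃ :+ :- (con (+ 10) :* Q₂ :+ con (+ 4) :* Q₃ :+ (s :+ :- con (+ 4)) :* Q₄)))
        refl s (Q 1F x y) (Q 2F x y) (Q 3F x y) (Q 4F x y)))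

    Q₂-diag : ∀ x → fromℕ 2 * Q 2F x x ≈ (s + - fromℕ 4) * (s + - fromℕ 9)
    Q₂-diag x = combine₂ (Q₁Q₁ x x) (Q₁-diag x)
      (solve 3 (λ s t Q₂ → con (+ 2) :* Q₂ :+ :- ((s :+ :- con (+ 4)) :* (s :+ :- con (+ 9))) :=
          (:- con (+ 1)) :* (t :* t :+ :- ((s :+ :- con (+ 4)) :+ con (+ 4) :* t :+ con (+ 2) :* Q₂))
          :+ (t :+ s :+ :- con (+ 8)) :* (t :+ :- (s :+ :- con (+ 4))))
        refl s (Q 1F x x) (Q 2F x x))

    -- The multiplicity m₂ = (s - 4)(s - 9)/2 is nonzero because b₀* and b₁* are, so the other
    -- factor vanishes. Thus `E 4F` has rank 5.
    Q₄-diag : ∀ x → Q 4F x x ≈ fromℕ 5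
    Q₄-diag x = [ (λ e → ⊥-elim (s-9≉0 (xy≈0⇒y≈0 s-4≉0 (trans (sym (Q₂-diag x)) (trans (*-congˡ e) (zeroʳ _))))))
                , x-y≈0⇒x≈y ]′ (xy≈0⇒x≈0⊎y≈0 (Q₂[Q₄-5]≈0 x x))

    Q-trace : ∀ x y → Q 0F x y + (Q 1F x y + (Q 2F x y + (Q 3F x y + (Q 4F x y + 0#)))) ≈ N * idM F x y
    Q-trace = Σ-Q≈N·I

    -- N is the sum of the multiplicities 1, s - 4, (s - 4)(s - 9)/2, 5(s - 4) and 5, where the
    -- fourth is read off from Q₃ = Q₁Q₄.
    2N≈s[s-1] : fromℕ 2 * N ≈ s * (s + - fromℕ 1)
    2N≈s[s-1] = combine₄ (Q₂-diag x₀) trace (Q₁-diag x₀) (Q₄-diag x₀)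
      (solve 5 (λ s N t Q₂ Q₄ → con (+ 2) :* N :+ :- (s :* (s :+ :- con (+ 1))) :=
         con (+ 1) :* (con (+ 2) :* Q₂ :+ :- ((s :+ :- con (+ 4)) :* (s :+ :- con (+ 9))))
         :+ (:- con (+ 2)) :* (con (+ 1) :+ ((s :+ :- con (+ 4)) :+ (Q₂ :+ (t :* Q₄ :+ (con (+ 5) :+ con (+ 0))))) :+ :- N)
         :+ con (+ 2) :* Q₄ :* (t :+ :- (s :+ :- con (+ 4)))
         :+ con (+ 2) :* (s :+ :- con (+ 4)) :* (Q₄ :+ :- con (+ 5)))
        refl s N (Q 1F x₀ x₀) (Q 2F x₀ x₀) (Q 4F x₀ x₀))
      where
      trace : fromℕ 1 + ((s + - fromℕ 4) + (Q 2F x₀ x₀ + (Q 1F x₀ x₀ * Q 4F x₀ x₀ + (fromℕ 5 + 0#)))) ≈ N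
      trace = trans (sym (sum₅-cong (Q₀≈fromℕ1 x₀ x₀) (Q₁-diag x₀) refl (sym (Q₁Q₄ x₀ x₀)) (Q₄-diag x₀)))
                    (trans (Q-trace x₀ x₀) (trans (*-congˡ (idM-diag x₀)) (*-identityʳ N)))

    -- If Q₂ = 0, the expansion of Q₁Q₂ collapses to (s - 9)(Q₁ + Q₃) = 0, hence Q₁(Q₄ + 1) = 0.
    -- Here Q₁ = 0 is impossible, since Q₁² = (s - 4) + 4Q₁ would force s = 4.
    Q₄∈5,-1 : ∀ x y → Q 4F x y ≈ fromℕ 5 ⊎
              (Q 4F x y ≈ - fromℕ 1 × (Q 1F x y + - fromℕ 2) * (Q 1F x y + - fromℕ 2) ≈ s)
    Q₄∈5,-1 x y = [ (λ Q₂≈0 → inj₂ (Q₄≈-1 Q₂≈0 , [t-2]² Q₂≈0)) , (λ e → inj₁ (x-y≈0⇒x≈y e)) ]′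
                  (xy≈0⇒x≈0⊎y≈0 (Q₂[Q₄-5]≈0 x y))
      where
      t Q₂ Q₃ Q₄ : Carrier
      t  = Q 1F x y
      Q₂ = Q 2F x y
      Q₃ = Q 3F x y
      Q₄ = Q 4F x y

      t+Q₃≈0 : Q₂ ≈ 0# → t + Q₃ ≈ 0#
      t+Q₃≈0 Q₂≈0 = xy≈0⇒y≈0 s-9≉0 (combine₂ (Q₁Q₂ x y) Q₂≈0
        (solve 4 (λ s t Q₂ Q₃ → (s :+ :- con (+ 9)) :* (t :+ Q₃) :+ :- con (+ 0) :=
           (:- con (+ 1)) :* (t :* Q₂ :+ :- ((s :+ :- con (+ 9)) :* t :+ (s :+ :- con (+ 16)) :* Q₂ :+ (s :+ :- con (+ 9)) :* Q₃))
           :+ (t :+ :- (s :+ :- con (+ 16))) :* (Q₂ :+ :- con (+ 0)))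
          refl s t Q₂ Q₃))

      t≉0 : Q₂ ≈ 0# → ¬ t ≈ 0#
      t≉0 Q₂≈0 t≈0 = s-4≉0 (combine₃ (Q₁Q₁ x y) t≈0 Q₂≈0
        (solve 3 (λ s t Q₂ → (s :+ :- con (+ 4)) :+ :- con (+ 0) :=
           (:- con (+ 1)) :* (t :* t :+ :- ((s :+ :- con (+ 4)) :+ con (+ 4) :* t :+ con (+ 2) :* Q₂))
           :+ (t :+ :- con (+ 4)) :* (t :+ :- con (+ 0))
           :+ (:- con (+ 2)) :* (Q₂ :+ :- con (+ 0)))
          refl s t Q₂))

      Q₄≈-1 : Q₂ ≈ 0# → Q₄ ≈ - fromℕ 1
      Q₄≈-1 Q₂≈0 = combine₁ (xy≈0⇒y≈0 {t} {Q₄ + fromℕ 1} (t≉0 Q₂≈0) (combine₂ (Q₁Q₄ x y) (t+Q₃≈0 Q₂≈0)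
        (solve 3 (λ t Q₃ Q₄ → t :* (Q₄ :+ con (+ 1)) :+ :- con (+ 0) :=
           con (+ 1) :* (t :* Q₄ :+ :- Q₃) :+ con (+ 1) :* (t :+ Q₃ :+ :- con (+ 0)))
          refl t Q₃ Q₄)))
        (solve 1 (λ Q₄ → Q₄ :+ :- (:- con (+ 1)) := con (+ 1) :* (Q₄ :+ con (+ 1) :+ :- con (+ 0))) refl Q₄)

      [t-2]² : Q₂ ≈ 0# → (t + - fromℕ 2) * (t + - fromℕ 2) ≈ s
      [t-2]² Q₂≈0 = combine₂ (Q₁Q₁ x y) Q₂≈0
        (solve 3 (λ s t Q₂ → (t :+ :- con (+ 2)) :* (t :+ :- con (+ 2)) :+ :- s :=
           con (+ 1) :* (t :* t :+ :- ((s :+ :- con (+ 4)) :+ con (+ 4) :* t :+ con (+ 2) :* Q₂))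
           :+ con (+ 2) :* (Q₂ :+ :- con (+ 0)))
          refl s t Q₂)

    -- The sign matrix.

    -- Off the diagonal Q₁ + 4 is ±r inside a class and Q₁ - 2 is ±r between classes. Adding Q₄ - 1,
    -- which is 4 or -2, merges both cases.
    P : Fin n → Fin n → Carrier
    P x y = Q 1F x y + Q 4F x y + - fromℕ 1

    P-diag : ∀ x → P x x ≈ s
    P-diag x = combine₂ (Q₁-diag x) (Q₄-diag x)
      (solve 3 (λ s t Q₄ → t :+ Q₄ :+ :- con (+ 1) :+ :- s :=
         con (+ 1) :* (t :+ :- (s :+ :- con (+ 4))) :+ con (+ 1) :* (Q₄ :+ :- con (+ 5))) refl s (Q 1F x x) (Q 4F x x))

    P-off : ∀ {x y} → ¬ x ≡ y → P x y * P x y ≈ s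
    P-off {x} {y} x≢y = [ same , (λ (e , h) → apart e h) ]′ (Q₄∈5,-1 x y)
      where
      t Q₂ Q₃ Q₄ : Carrier
      t  = Q 1F x y
      Q₂ = Q 2F x y
      Q₃ = Q 3F x y
      Q₄ = Q 4F x y

      trace : fromℕ 1 + (t + (Q₂ + (Q₃ + (Q₄ + 0#)))) ≈ 0#
      trace = trans (sym (sum₅-cong (Q₀≈fromℕ1 x y) refl refl refl refl))
                    (trans (Q-trace x y) (trans (*-congˡ (idM-off x≢y)) (zeroʳ N)))

      same : Q₄ ≈ fromℕ 5 → P x y * P x y ≈ s
      -- Inside a class Q₂ need not vanish; off the diagonal all Qᵢ sum to 0, which gives Q₂ = -6 -
      -- 6Q₁, and substitution into the formula for Q₁² completes the square.
      same e = combine₄ trace (Q₁Q₁ x y) (Q₁Q₄ x y) e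
        (solve 5 (λ s t Q₂ Q₃ Q₄ → (t :+ Q₄ :+ :- con (+ 1)) :* (t :+ Q₄ :+ :- con (+ 1)) :+ :- s :=
           con (+ 2) :* (con (+ 1) :+ (t :+ (Q₂ :+ (Q₃ :+ (Q₄ :+ con (+ 0))))) :+ :- con (+ 0))
           :+ con (+ 1) :* (t :* t :+ :- ((s :+ :- con (+ 4)) :+ con (+ 4) :* t :+ con (+ 2) :* Q₂))
           :+ con (+ 2) :* (t :* Q₄ :+ :- Q₃)
           :+ (Q₄ :+ con (+ 1)) :* (Q₄ :+ :- con (+ 5)))
          refl s t Q₂ Q₃ Q₄)

      apart : Q₄ ≈ - fromℕ 1 → (t + - fromℕ 2) * (t + - fromℕ 2) ≈ s → P x y * P x y ≈ s
      apart e h = combine₂ e h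
        (solve 3 (λ s t Q₄ → (t :+ Q₄ :+ :- con (+ 1)) :* (t :+ Q₄ :+ :- con (+ 1)) :+ :- s :=
           (con (+ 2) :* t :+ Q₄ :+ :- con (+ 3)) :* (Q₄ :+ :- (:- con (+ 1)))
           :+ con (+ 1) :* ((t :+ :- con (+ 2)) :* (t :+ :- con (+ 2)) :+ :- s))
          refl s t Q₄)

    IsBit : Carrier → Set _
    IsBit d = d ≈ fromℕ 0 ⊎ d ≈ fromℕ 1

    bit-integer : ∀ {d} → IsBit d → IsInteger d
    bit-integer (inj₁ e) = + 0 , e
    bit-integer (inj₂ e) = + 1 , e

    -- The diagonal entry s is not ±r. It is assigned the sign +1 by convention, and the error s - r
    -- is carried by the identity matrix.
    bit : ∀ x y → Σ Carrier λ d → IsBit d × P x y ≈ r * (d + d + - fromℕ 1) + idM F x y * (s + - r)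
    bit x y with x ≟ y
    ... | yes ≡.refl = fromℕ 1 , inj₂ refl , trans (P-diag x)
          (trans (solve 2 (λ s r → s := r :* (con (+ 1) :+ con (+ 1) :+ :- con (+ 1)) :+ (s :+ :- r)) refl s r)
                 (+-congˡ (sym (*-identityˡ _))))
    ... | no x≢y = [ (λ e → fromℕ 1 , inj₂ refl , trans e
                        (solve 2 (λ r k → r := r :* (con (+ 1) :+ con (+ 1) :+ :- con (+ 1)) :+ con (+ 0) :* k) refl r (s + - r)))
                   , (λ e → fromℕ 0 , inj₁ refl , trans e
                        (solve 2 (λ r k → :- r := r :* (con (+ 0) :+ con (+ 0) :+ :- con (+ 1)) :+ con (+ 0) :* k) refl r (s + - r))) ]′
                   (xx≈yy⇒x≈±y (P-off x≢y))

    δ : Fin n → Fin n → Carrier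
    δ x y = proj₁ (bit x y)

    ε : Fin n → Fin n → Carrier
    ε x y = δ x y + δ x y + - fromℕ 1

    δ-integer : ∀ x y → IsInteger (δ x y)
    δ-integer x y = bit-integer (proj₁ (proj₂ (bit x y)))

    ε-integer : ∀ x y → IsInteger (ε x y)
    ε-integer x y = integer-+ (integer-+ (δ-integer x y) (δ-integer x y)) (integer-neg (integer-fromℕ 1))

    P≈rε : ∀ x y → P x y ≈ r * ε x y + idM F x y * (s + - r)
    P≈rε x y = proj₂ (proj₂ (bit x y))

    -- The six classes.

    Apart : Fin n → Fin n → Set _
    Apart x y = Q 4F x y ≈ - fromℕ 1

    apart-sym : ∀ {x y} → Apart x y → Apart y x
    apart-sym {x} {y} h = trans (Q-sym 4F y x) h

    -- Six times the indicator function of the class of y.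
    ω : Fin n → Fin n → Carrier
    ω y z = fromℕ 1 + Q 4F y z

    indicator : ∀ y z → Σ Carrier λ χ → IsBit χ × ω y z ≈ fromℕ 6 * χ
    indicator y z = [ (λ e → fromℕ 1 , inj₂ refl , combine₁ e
                        (solve 1 (λ a → con (+ 1) :+ a :+ :- (con (+ 6) :* con (+ 1)) := con (+ 1) :* (a :+ :- con (+ 5))) refl (Q 4F y z)))
                    , (λ (e , _) → fromℕ 0 , inj₁ refl , combine₁ e
                        (solve 1 (λ a → con (+ 1) :+ a :+ :- (con (+ 6) :* con (+ 0)) := con (+ 1) :* (a :+ :- (:- con (+ 1)))) refl (Q 4F y z))) ]′
                    (Q₄∈5,-1 y z)

    χ : Fin n → Fin n → Carrier
    χ y z = proj₁ (indicator y z)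

    χ-integer : ∀ y z → IsInteger (χ y z)
    χ-integer y z = bit-integer (proj₁ (proj₂ (indicator y z)))

    ω≈6χ : ∀ y z → ω y z ≈ fromℕ 6 * χ y z
    ω≈6χ y z = proj₂ (proj₂ (indicator y z))

    apart⇒ω≈0 : ∀ {y z} → Apart y z → ω y z ≈ 0#
    apart⇒ω≈0 {y} {z} h = trans (+-congˡ h) (-‿inverseʳ _)

    -- The squared distance of the two rows is N(Q₄(y,y) - 2Q₄(y,z) + Q₄(z,z)) = N(5 - 10 + 5). This
    -- is the transitivity of the relation Q₄ = 5.
    Q₄-rows-equal : ∀ {y z} → Q 4F y z ≈ fromℕ 5 → ∀ u → Q 4F y u ≈ Q 4F z u
    Q₄-rows-equal {y} {z} h u = x-y≈0⇒x≈y (Σ-squares≈0 (λ u → Q 4F y u + - Q 4F z u) (begin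
      Σ[< n ] (λ u → (Q 4F y u + - Q 4F z u) * (Q 4F y u + - Q 4F z u))
        ≈⟨ Σ-cong {n} (λ u → solve 2 (λ a b → (a :+ :- b) :* (a :+ :- b) := a :* a :+ ((:- con (+ 2)) :* (a :* b) :+ b :* b)) refl (Q 4F y u) (Q 4F z u)) ⟩
      Σ[< n ] (λ u → Q 4F y u * Q 4F y u + (- fromℕ 2 * (Q 4F y u * Q 4F z u) + Q 4F z u * Q 4F z u))
        ≈⟨ trans (Σ-+ (λ u → Q 4F y u * Q 4F y u) (λ u → - fromℕ 2 * (Q 4F y u * Q 4F z u) + Q 4F z u * Q 4F z u))
             (+-congˡ (trans (Σ-+ (λ u → - fromℕ 2 * (Q 4F y u * Q 4F z u)) (λ u → Q 4F z u * Q 4F z u))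
               (+-congʳ (Σ-*ˡ (- fromℕ 2) (λ u → Q 4F y u * Q 4F z u))))) ⟩
      Σ[< n ] (λ u → Q 4F y u * Q 4F y u) + (- fromℕ 2 * Σ[< n ] (λ u → Q 4F y u * Q 4F z u) + Σ[< n ] (λ u → Q 4F z u * Q 4F z u))
        ≈⟨ +-cong (trans (Q-idempotent 4F y y) (*-congˡ (Q₄-diag y)))
             (+-cong (*-congˡ (trans (Q-idempotent 4F y z) (*-congˡ h))) (trans (Q-idempotent 4F z z) (*-congˡ (Q₄-diag z)))) ⟩
      N * fromℕ 5 + (- fromℕ 2 * (N * fromℕ 5) + N * fromℕ 5)
        ≈⟨ solve 1 (λ N → N :* con (+ 5) :+ ((:- con (+ 2)) :* (N :* con (+ 5)) :+ N :* con (+ 5)) := con (+ 0)) refl N ⟩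
      0# ∎) u)

    ω·Q₄ : ∀ u y z → ω y z * Q 4F u z ≈ ω y z * Q 4F u y
    ω·Q₄ u y z = [ (λ e → *-congˡ (trans (Q-sym 4F u z) (trans (sym (Q₄-rows-equal e u)) (Q-sym 4F y u))))
                 , (λ (e , _) → trans (trans (*-congʳ (apart⇒ω≈0 e)) (zeroˡ _)) (sym (trans (*-congʳ (apart⇒ω≈0 e)) (zeroˡ _)))) ]′
                 (Q₄∈5,-1 y z)

    -- Q₄(u,·) is constant on the class of y, so there P and Q₁ differ by a constant: 4 if u lies in
    -- that class, -2 otherwise. Sums of signs over a class thereby become sums of products of Q₁.
    ω·P : ∀ {k u y} → Q 4F u y ≈ k → ∀ z → ω y z * P u z ≈ ω y z * (Q 1F u z + (k + - fromℕ 1))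
    ω·P {k} {u} {y} h z = combine₂ (ω·Q₄ u y z) h
      (solve 5 (λ w t a b k → w :* (t :+ a :+ :- con (+ 1)) :+ :- (w :* (t :+ (k :+ :- con (+ 1)))) :=
         con (+ 1) :* (w :* a :+ :- (w :* b)) :+ w :* (b :+ :- k)) refl (ω y z) (Q 1F u z) (Q 4F u z) (Q 4F u y) k)

    ω·I : ∀ {u y} → Apart u y → ∀ z → ω y z * idM F u z ≈ 0#
    ω·I {u} {y} h z with u ≟ z
    ... | yes ≡.refl = trans (*-congʳ (apart⇒ω≈0 (apart-sym h))) (zeroˡ _)
    ... | no  _      = zeroʳ _

    ω·P≈ω·rε : ∀ {u y} → Apart u y → ∀ z → ω y z * P u z ≈ ω y z * (r * ε u z)
    ω·P≈ω·rε {u} {y} h z = combine₂ (P≈rε u z) (ω·I h z)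
      (solve 6 (λ w p r e i k → w :* p :+ :- (w :* (r :* e)) :=
         w :* (p :+ :- (r :* e :+ i :* k)) :+ k :* (w :* i :+ :- con (+ 0))) refl (ω y z) (P u z) r (ε u z) (idM F u z) (s + - r))

    P-apart : ∀ {u v} → Apart u v → P u v ≈ r * ε u v
    P-apart {u} {v} h = trans (P≈rε u v) (trans (+-congˡ (trans (*-congʳ (idM-off u≢v)) (zeroˡ _))) (+-identityʳ _))
      where
      u≢v : ¬ u ≡ v
      u≢v ≡.refl = fromℕ-≉0 5 (combine₂ (Q₄-diag u) h
        (solve 1 (λ a → con (+ 6) :+ :- con (+ 0) := (:- con (+ 1)) :* (a :+ :- con (+ 5)) :+ con (+ 1) :* (a :+ :- (:- con (+ 1)))) refl (Q 4F u u)))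

    Q₁-apart : ∀ {u v} → Apart u v → Q 1F u v ≈ fromℕ 2 + r * ε u v
    Q₁-apart {u} {v} h = combine₂ (P-apart h) h
      (solve 3 (λ t a e → t :+ :- (con (+ 2) :+ e) := con (+ 1) :* (t :+ a :+ :- con (+ 1) :+ :- e) :+ (:- con (+ 1)) :* (a :+ :- (:- con (+ 1))))
        refl (Q 1F u v) (Q 4F u v) (r * ε u v))

    -- Vanishing triple and fourfold sums.

    -- As q₁₁³ = q₁₁⁴ = 0, Q₁ ∘ Q₁ lies in the span of Q₀, Q₁, Q₂, so orthogonality of d to their
    -- rows is enough.
    Q₁Q₁-annihilates : ∀ (d : Fin n → Carrier) → Σ[< n ] d ≈ 0# →
      (∀ x → Σ[< n ] (λ z → Q 1F x z * d z) ≈ 0#) → (∀ x → Σ[< n ] (λ z → Q 2F x z * d z) ≈ 0#) →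
      ∀ x → Σ[< n ] (λ z → Q 1F x z * Q 1F x z * d z) ≈ 0#
    Q₁Q₁-annihilates d h₀ h₁ h₂ x = begin
      Σ[< n ] (λ z → Q 1F x z * Q 1F x z * d z)
        ≈⟨ Σ-cong {n} (λ z → trans (*-congʳ (Q₁Q₁ x z))
             (solve 4 (λ b t Q₂ d → (b :+ con (+ 4) :* t :+ con (+ 2) :* Q₂) :* d :=
                b :* d :+ (con (+ 4) :* (t :* d) :+ con (+ 2) :* (Q₂ :* d))) refl (s + - fromℕ 4) (Q 1F x z) (Q 2F x z) (d z))) ⟩
      Σ[< n ] (λ z → (s + - fromℕ 4) * d z + (fromℕ 4 * (Q 1F x z * d z) + fromℕ 2 * (Q 2F x z * d z)))
        ≈⟨ Σ-*+ (s + - fromℕ 4) d (λ z → fromℕ 4 * (Q 1F x z * d z) + fromℕ 2 * (Q 2F x z * d z)) ⟩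
      (s + - fromℕ 4) * Σ[< n ] d + Σ[< n ] (λ z → fromℕ 4 * (Q 1F x z * d z) + fromℕ 2 * (Q 2F x z * d z))
        ≈⟨ +-cong (*-congˡ h₀) (trans (Σ-*+ (fromℕ 4) (λ z → Q 1F x z * d z) (λ z → fromℕ 2 * (Q 2F x z * d z)))
             (+-cong (*-congˡ (h₁ x)) (trans (Σ-*ˡ (fromℕ 2) (λ z → Q 2F x z * d z)) (*-congˡ (h₂ x))))) ⟩
      (s + - fromℕ 4) * 0# + (fromℕ 4 * 0# + fromℕ 2 * 0#)
        ≈⟨ solve 1 (λ b → b :* con (+ 0) :+ (con (+ 4) :* con (+ 0) :+ con (+ 2) :* con (+ 0)) := con (+ 0)) refl (s + - fromℕ 4) ⟩
      0# ∎

    -- As q₁₂⁰ = q₁₂⁴ = 0, only Q₁, Q₂ and Q₃ occur in Q₁ ∘ Q₂.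
    Q₁Q₂-annihilates : ∀ (d : Fin n → Carrier) → (∀ x → Σ[< n ] (λ z → Q 1F x z * d z) ≈ 0#) →
      (∀ x → Σ[< n ] (λ z → Q 2F x z * d z) ≈ 0#) → (∀ x → Σ[< n ] (λ z → Q 3F x z * d z) ≈ 0#) →
      ∀ x → Σ[< n ] (λ z → Q 1F x z * Q 2F x z * d z) ≈ 0#
    Q₁Q₂-annihilates d h₁ h₂ h₃ x = begin
      Σ[< n ] (λ z → Q 1F x z * Q 2F x z * d z)
        ≈⟨ Σ-cong {n} (λ z → trans (*-congʳ (Q₁Q₂ x z))
             (solve 6 (λ b a t Q₂ Q₃ d → (b :* t :+ a :* Q₂ :+ b :* Q₃) :* d :=
                b :* (t :* d) :+ (a :* (Q₂ :* d) :+ b :* (Q₃ :* d))) refl β α (Q 1F x z) (Q 2F x z) (Q 3F x z) (d z))) ⟩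
      Σ[< n ] (λ z → β * (Q 1F x z * d z) + (α * (Q 2F x z * d z) + β * (Q 3F x z * d z)))
        ≈⟨ Σ-*+ β (λ z → Q 1F x z * d z) (λ z → α * (Q 2F x z * d z) + β * (Q 3F x z * d z)) ⟩
      β * Σ[< n ] (λ z → Q 1F x z * d z) + Σ[< n ] (λ z → α * (Q 2F x z * d z) + β * (Q 3F x z * d z))
        ≈⟨ +-cong (*-congˡ (h₁ x)) (trans (Σ-*+ α (λ z → Q 2F x z * d z) (λ z → β * (Q 3F x z * d z)))
             (+-cong (*-congˡ (h₂ x)) (trans (Σ-*ˡ β (λ z → Q 3F x z * d z)) (*-congˡ (h₃ x))))) ⟩
      β * 0# + (α * 0# + β * 0#)
        ≈⟨ solve 2 (λ b a → b :* con (+ 0) :+ (a :* con (+ 0) :+ b :* con (+ 0)) := con (+ 0)) refl β α ⟩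
      0# ∎
      where
      α β : Carrier
      α = s + - fromℕ 16
      β = s + - fromℕ 9

    ΣQ₁Q₁Q₄≈0 : ∀ u v y → Σ[< n ] (λ z → Q 1F u z * Q 1F v z * Q 4F y z) ≈ 0#
    ΣQ₁Q₁Q₄≈0 u v y = triple-sum-vanishes 1F 1F (Q 4F y)
      (Q₁Q₁-annihilates (Q 4F y) (row-sum (λ ()) y) (λ x → Q-orthogonal (λ ()) x y) (λ x → Q-orthogonal (λ ()) x y)) u v

    ΣQ₁Q₂Q₄≈0 : ∀ u v y → Σ[< n ] (λ z → Q 1F u z * Q 2F v z * Q 4F y z) ≈ 0#
    ΣQ₁Q₂Q₄≈0 u v y = triple-sum-vanishes 1F 2F (Q 4F y)
      (Q₁Q₂-annihilates (Q 4F y) (λ x → Q-orthogonal (λ ()) x y) (λ x → Q-orthogonal (λ ()) x y) (λ x → Q-orthogonal (λ ()) x y)) u v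

    -- Equivalently, Σ_z Q₁(u,z) Q₁(v,z) Q₁(w,z) has the same value over every class.
    ΣQ₁Q₁Q₁Q₄≈0 : ∀ u v w y → Σ[< n ] (λ z → Q 1F v z * Q 1F w z * (Q 1F u z * Q 4F y z)) ≈ 0#
    ΣQ₁Q₁Q₁Q₄≈0 u v w y = triple-sum-vanishes 1F 1F (λ z → Q 1F u z * Q 4F y z)
      (Q₁Q₁-annihilates (λ z → Q 1F u z * Q 4F y z) (Q-orthogonal (λ ()) u y)
        (λ x → trans (Σ-cong {n} (λ z → sym (*-assoc (Q 1F x z) (Q 1F u z) (Q 4F y z)))) (ΣQ₁Q₁Q₄≈0 x u y))
        (λ x → trans (Σ-cong {n} (λ z → solve 3 (λ a b c → a :* (b :* c) := b :* a :* c) refl (Q 2F x z) (Q 1F u z) (Q 4F y z)))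
                     (ΣQ₁Q₂Q₄≈0 u x y))) v w

    -- Moments of Q₁ and P over one class.

    Σω : ∀ y → Σ[< n ] (ω y) ≈ N
    Σω y = trans (Σ-+ (λ _ → fromℕ 1) (Q 4F y)) (trans (+-cong (Σ-const n (fromℕ 1)) (row-sum (λ ()) y))
      (solve 1 (λ N → N :* con (+ 1) :+ con (+ 0) := N) refl N))

    -- Orthogonality of f to Q₄(y,·) says that the class of y carries exactly one sixth of the total
    -- of f.
    Σω· : ∀ y (f : Fin n → Carrier) → Σ[< n ] (λ z → f z * Q 4F y z) ≈ 0# → Σ[< n ] (λ z → ω y z * f z) ≈ Σ[< n ] f
    Σω· y f h = trans (Σ-cong {n} (λ z → solve 2 (λ a f → (con (+ 1) :+ a) :* f := f :+ f :* a) refl (Q 4F y z) (f z)))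
      (trans (Σ-+ f (λ z → f z * Q 4F y z)) (trans (+-congˡ h) (+-identityʳ _)))

    ΣωQ₁ : ∀ y u → Σ[< n ] (λ z → ω y z * Q 1F u z) ≈ 0#
    ΣωQ₁ y u = trans (Σω· y (Q 1F u) (Q-orthogonal (λ ()) u y)) (row-sum (λ ()) u)

    ΣωQ₁Q₁ : ∀ y u v → Σ[< n ] (λ z → ω y z * (Q 1F u z * Q 1F v z)) ≈ N * Q 1F u v
    ΣωQ₁Q₁ y u v = trans (Σω· y (λ z → Q 1F u z * Q 1F v z) (ΣQ₁Q₁Q₄≈0 u v y)) (Q-idempotent 1F u v)

    cubic : Fin n → Fin n → Fin n → Carrier
    cubic u v w = Σ[< n ] (λ z → Q 1F v z * Q 1F w z * Q 1F u z)

    ΣωQ₁Q₁Q₁ : ∀ y u v w → Σ[< n ] (λ z → ω y z * (Q 1F v z * Q 1F w z * Q 1F u z)) ≈ cubic u v w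
    ΣωQ₁Q₁Q₁ y u v w = Σω· y (λ z → Q 1F v z * Q 1F w z * Q 1F u z)
      (trans (Σ-cong {n} (λ z → *-assoc (Q 1F v z * Q 1F w z) (Q 1F u z) (Q 4F y z))) (ΣQ₁Q₁Q₁Q₄≈0 u v w y))

    ΣωP : ∀ {k u y} → (∀ z → ω y z * P u z ≈ ω y z * (Q 1F u z + k)) → Σ[< n ] (λ z → ω y z * P u z) ≈ N * k
    ΣωP {k} {u} {y} h = begin
      Σ[< n ] (λ z → ω y z * P u z)
        ≈⟨ Σ-cong {n} (λ z → trans (h z) (solve 3 (λ w t k → w :* (t :+ k) := k :* w :+ w :* t) refl (ω y z) (Q 1F u z) k)) ⟩
      Σ[< n ] (λ z → k * ω y z + ω y z * Q 1F u z)
        ≈⟨ Σ-*+ k (ω y) (λ z → ω y z * Q 1F u z) ⟩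
      k * Σ[< n ] (ω y) + Σ[< n ] (λ z → ω y z * Q 1F u z)
        ≈⟨ +-cong (*-congˡ (Σω y)) (ΣωQ₁ y u) ⟩
      k * N + 0#
        ≈⟨ solve 2 (λ k N → k :* N :+ con (+ 0) := N :* k) refl k N ⟩
      N * k ∎

    ΣωPP : ∀ {k l u v y} → (∀ z → ω y z * P u z ≈ ω y z * (Q 1F u z + k)) → (∀ z → ω y z * P v z ≈ ω y z * (Q 1F v z + l)) →
           Σ[< n ] (λ z → ω y z * (P u z * P v z)) ≈ N * (Q 1F u v + k * l)
    ΣωPP {k} {l} {u} {v} {y} hu hv = begin
      Σ[< n ] (λ z → ω y z * (P u z * P v z))
        ≈⟨ Σ-cong {n} (λ z → combine₂ (hu z) (hv z)
             (solve 7 (λ w p p′ t t′ k l → w :* (p :* p′) :+ :- (l :* (w :* t) :+ (k :* (w :* t′) :+ (k :* l :* w :+ w :* (t :* t′)))) :=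
                p′ :* (w :* p :+ :- (w :* (t :+ k))) :+ (t :+ k) :* (w :* p′ :+ :- (w :* (t′ :+ l))))
               refl (ω y z) (P u z) (P v z) (Q 1F u z) (Q 1F v z) k l)) ⟩
      Σ[< n ] (λ z → l * (ω y z * Q 1F u z) + (k * (ω y z * Q 1F v z) + (k * l * ω y z + ω y z * (Q 1F u z * Q 1F v z))))
        ≈⟨ trans (Σ-*+ l _ (λ z → k * (ω y z * Q 1F v z) + (k * l * ω y z + ω y z * (Q 1F u z * Q 1F v z)))) (+-congˡ (trans
             (Σ-*+ k _ (λ z → k * l * ω y z + ω y z * (Q 1F u z * Q 1F v z))) (+-congˡ
             (Σ-*+ (k * l) (ω y) (λ z → ω y z * (Q 1F u z * Q 1F v z)))))) ⟩
      l * Σ[< n ] (λ z → ω y z * Q 1F u z) + (k * Σ[< n ] (λ z → ω y z * Q 1F v z)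
        + (k * l * Σ[< n ] (ω y) + Σ[< n ] (λ z → ω y z * (Q 1F u z * Q 1F v z))))
        ≈⟨ +-cong (*-congˡ (ΣωQ₁ y u)) (+-cong (*-congˡ (ΣωQ₁ y v)) (+-cong (*-congˡ (Σω y)) (ΣωQ₁Q₁ y u v))) ⟩
      l * 0# + (k * 0# + (k * l * N + N * Q 1F u v))
        ≈⟨ solve 4 (λ k l N a → l :* con (+ 0) :+ (k :* con (+ 0) :+ (k :* l :* N :+ N :* a)) := N :* (a :+ k :* l)) refl k l N (Q 1F u v) ⟩
      N * (Q 1F u v + k * l) ∎

    -- In the expansion of (Q₁ + k)(Q₁ + l)(Q₁ + m) the linear terms sum to 0, the quadratic ones to
    -- multiples of N Q₁, and the cubic one to `cubic`, the only unknown and independent of y.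
    ΣωPPP : ∀ {k l m u v w y} → (∀ z → ω y z * P u z ≈ ω y z * (Q 1F u z + k)) →
            (∀ z → ω y z * P v z ≈ ω y z * (Q 1F v z + l)) → (∀ z → ω y z * P w z ≈ ω y z * (Q 1F w z + m)) →
            Σ[< n ] (λ z → ω y z * (P u z * (P v z * P w z))) ≈
            cubic u v w + N * (k * Q 1F v w + l * Q 1F u w + m * Q 1F u v + k * l * m)
    ΣωPPP {k} {l} {m} {u} {v} {w} {y} hu hv hw = begin
      Σ[< n ] (λ z → ω y z * (P u z * (P v z * P w z)))
        ≈⟨ Σ-cong {n} (λ z → combine₁ (hu z)
             (solve 5 (λ w p p′ t k → w :* (p :* p′) :+ :- (k :* (w :* p′) :+ w :* (t :* p′)) :=
                p′ :* (w :* p :+ :- (w :* (t :+ k))))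
               refl (ω y z) (P u z) (P v z * P w z) (Q 1F u z) k)) ⟩
      Σ[< n ] (λ z → k * (ω y z * (P v z * P w z)) + ω y z * (Q 1F u z * (P v z * P w z)))
        ≈⟨ Σ-*+ k (λ z → ω y z * (P v z * P w z)) (λ z → ω y z * (Q 1F u z * (P v z * P w z))) ⟩
      k * Σ[< n ] (λ z → ω y z * (P v z * P w z)) + Σ[< n ] (λ z → ω y z * (Q 1F u z * (P v z * P w z)))
        ≈⟨ +-cong (*-congˡ (ΣωPP hv hw)) Q₁PP ⟩
      k * (N * (Q 1F v w + l * m)) + (m * (N * Q 1F u v) + (l * (N * Q 1F u w) + (l * m * 0# + cubic u v w)))
        ≈⟨ solve 8 (λ N k l m a b c T → k :* (N :* (a :+ l :* m)) :+ (m :* (N :* c) :+ (l :* (N :* b) :+ (l :* m :* con (+ 0) :+ T))) :=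
             T :+ N :* (k :* a :+ l :* b :+ m :* c :+ k :* l :* m)) refl N k l m (Q 1F v w) (Q 1F u w) (Q 1F u v) (cubic u v w) ⟩
      cubic u v w + N * (k * Q 1F v w + l * Q 1F u w + m * Q 1F u v + k * l * m) ∎
      where
      Q₁PP : Σ[< n ] (λ z → ω y z * (Q 1F u z * (P v z * P w z))) ≈
             m * (N * Q 1F u v) + (l * (N * Q 1F u w) + (l * m * 0# + cubic u v w))
      Q₁PP = begin
        Σ[< n ] (λ z → ω y z * (Q 1F u z * (P v z * P w z)))
          ≈⟨ Σ-cong {n} (λ z → combine₂ (hv z) (hw z)
               (solve 8 (λ o a p p′ t t′ l m → o :* (a :* (p :* p′)) :+ :- (m :* (o :* (a :* t)) :+ (l :* (o :* (a :* t′)) :+ (l :* m :* (o :* a) :+ o :* (t :* t′ :* a)))) :=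
                  (a :* p′) :* (o :* p :+ :- (o :* (t :+ l))) :+ (a :* (t :+ l)) :* (o :* p′ :+ :- (o :* (t′ :+ m))))
                 refl (ω y z) (Q 1F u z) (P v z) (P w z) (Q 1F v z) (Q 1F w z) l m)) ⟩
        Σ[< n ] (λ z → m * (ω y z * (Q 1F u z * Q 1F v z)) + (l * (ω y z * (Q 1F u z * Q 1F w z))
          + (l * m * (ω y z * Q 1F u z) + ω y z * (Q 1F v z * Q 1F w z * Q 1F u z))))
          ≈⟨ trans (Σ-*+ m (λ z → ω y z * (Q 1F u z * Q 1F v z)) (λ z → l * (ω y z * (Q 1F u z * Q 1F w z))
               + (l * m * (ω y z * Q 1F u z) + ω y z * (Q 1F v z * Q 1F w z * Q 1F u z)))) (+-congˡ (trans
               (Σ-*+ l (λ z → ω y z * (Q 1F u z * Q 1F w z)) (λ z → l * m * (ω y z * Q 1F u z) + ω y z * (Q 1F v z * Q 1F w z * Q 1F u z))) (+-congˡ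
               (Σ-*+ (l * m) (λ z → ω y z * Q 1F u z) (λ z → ω y z * (Q 1F v z * Q 1F w z * Q 1F u z)))))) ⟩
        _ ≈⟨ +-cong (*-congˡ (ΣωQ₁Q₁ y u v)) (+-cong (*-congˡ (ΣωQ₁Q₁ y u w)) (+-cong (*-congˡ (ΣωQ₁ y u)) (ΣωQ₁Q₁Q₁ y u v w))) ⟩
        m * (N * Q 1F u v) + (l * (N * Q 1F u w) + (l * m * 0# + cubic u v w)) ∎

    -- Sums of products of signs over one class.

    r≉0 : ¬ r ≈ 0#
    r≉0 = pos⇒≉0 r>0

    s≉0 : ¬ s ≈ 0#
    s≉0 h = r≉0 (xy≈0⇒y≈0 r≉0 h)

    class-size : Fin n → Carrier
    class-size y = Σ[< n ] (χ y)

    S₁ : Fin n → Fin n → Carrier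
    S₁ y u = Σ[< n ] (λ z → χ y z * ε u z)

    S₂ : Fin n → Fin n → Fin n → Carrier
    S₂ y u v = Σ[< n ] (λ z → χ y z * (ε u z * ε v z))

    S₃ : Fin n → Fin n → Fin n → Fin n → Carrier
    S₃ y u v w = Σ[< n ] (λ z → χ y z * (ε u z * (ε v z * ε w z)))

    S₁-integer : ∀ y u → IsInteger (S₁ y u)
    S₁-integer y u = Σ-integer {n} (λ z → integer-* (χ-integer y z) (ε-integer u z))

    S₂-integer : ∀ y u v → IsInteger (S₂ y u v)
    S₂-integer y u v = Σ-integer {n} (λ z → integer-* (χ-integer y z) (integer-* (ε-integer u z) (ε-integer v z)))

    S₃-integer : ∀ y u v w → IsInteger (S₃ y u v w)
    S₃-integer y u v w = Σ-integer {n} (λ z → integer-* (χ-integer y z)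
      (integer-* (ε-integer u z) (integer-* (ε-integer v z) (ε-integer w z))))

    6·class-size : ∀ y → fromℕ 6 * class-size y ≈ N
    6·class-size y = trans (sym (Σ-*ˡ (fromℕ 6) (χ y))) (trans (Σ-cong {n} (λ z → sym (ω≈6χ y z))) (Σω y))

    -- The first moment is -2N, and 2N = s(s - 1); dividing by r leaves one factor r, so r(s - 1) is
    -- integral.
    S₁-value : ∀ {u y} → Apart u y → fromℕ 6 * S₁ y u ≈ - (r * (s + - fromℕ 1))
    S₁-value {u} {y} uy = *-cancel-≉0 r≉0 (*-cancel-≉0 (fromℕ-≉0 1) (combine₂ moment 2N≈s[s-1]
      (solve 3 (λ r S N → con (+ 2) :* (r :* (con (+ 6) :* S)) :+ :- (con (+ 2) :* (r :* (:- (r :* (r :* r :+ :- con (+ 1)))))) :=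
         con (+ 2) :* (con (+ 6) :* r :* S :+ :- (N :* (:- con (+ 1) :+ :- con (+ 1)))) :+
         (:- con (+ 2)) :* (con (+ 2) :* N :+ :- (r :* r :* (r :* r :+ :- con (+ 1))))) refl r (S₁ y u) N)))
      where
      moment : fromℕ 6 * r * S₁ y u ≈ N * (- fromℕ 1 + - fromℕ 1)
      moment = begin
        fromℕ 6 * r * S₁ y u                        ≈⟨ Σ-*ˡ (fromℕ 6 * r) (λ z → χ y z * ε u z) ⟨
        Σ[< n ] (λ z → fromℕ 6 * r * (χ y z * ε u z)) ≈⟨ Σ-cong {n} (λ z → combine₂ (ω≈6χ y z) (ω·P≈ω·rε uy z)
          (solve 5 (λ r c e w p → con (+ 6) :* r :* (c :* e) :+ :- (w :* p) :=
             (:- (r :* e)) :* (w :+ :- (con (+ 6) :* c)) :+ (:- con (+ 1)) :* (w :* p :+ :- (w :* (r :* e))))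
            refl r (χ y z) (ε u z) (ω y z) (P u z))) ⟩
        Σ[< n ] (λ z → ω y z * P u z)               ≈⟨ ΣωP (ω·P uy) ⟩
        N * (- fromℕ 1 + - fromℕ 1)                 ∎

    S₂-value : ∀ {u v y} → Apart u v → Apart u y → Apart v y →
               fromℕ 12 * S₂ y u v ≈ (s + - fromℕ 1) * (fromℕ 6 + r * ε u v)
    S₂-value {u} {v} {y} uv uy vy = *-cancel-≉0 s≉0 (combine₃ moment (Q₁-apart uv) 2N≈s[s-1]
      (solve 5 (λ r S N a e → r :* r :* (con (+ 12) :* S) :+ :- (r :* r :* ((r :* r :+ :- con (+ 1)) :* (con (+ 6) :+ r :* e))) :=
         con (+ 2) :* (con (+ 6) :* (r :* r) :* S :+ :- (N :* (a :+ (:- con (+ 1) :+ :- con (+ 1)) :* (:- con (+ 1) :+ :- con (+ 1)))))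
         :+ (con (+ 2) :* N) :* (a :+ :- (con (+ 2) :+ r :* e))
         :+ (con (+ 6) :+ r :* e) :* (con (+ 2) :* N :+ :- (r :* r :* (r :* r :+ :- con (+ 1)))))
        refl r (S₂ y u v) N (Q 1F u v) (ε u v)))
      where
      moment : fromℕ 6 * s * S₂ y u v ≈ N * (Q 1F u v + (- fromℕ 1 + - fromℕ 1) * (- fromℕ 1 + - fromℕ 1))
      moment = begin
        fromℕ 6 * s * S₂ y u v
          ≈⟨ Σ-*ˡ (fromℕ 6 * s) (λ z → χ y z * (ε u z * ε v z)) ⟨
        Σ[< n ] (λ z → fromℕ 6 * s * (χ y z * (ε u z * ε v z)))
          -- The coefficients telescope: `ω` is exchanged for 6`χ`, and the factors P for r`ε` one
          -- after another.
          ≈⟨ Σ-cong {n} (λ z → combine₃ (ω≈6χ y z) (ω·P≈ω·rε uy z) (ω·P≈ω·rε vy z)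
               (solve 7 (λ r c d e w p o → con (+ 6) :* (r :* r) :* (c :* (d :* e)) :+ :- (w :* (p :* o)) :=
                  (:- (r :* d :* (r :* e))) :* (w :+ :- (con (+ 6) :* c)) :+ (:- o) :* (w :* p :+ :- (w :* (r :* d)))
                  :+ (:- (r :* d)) :* (w :* o :+ :- (w :* (r :* e))))
                 refl r (χ y z) (ε u z) (ε v z) (ω y z) (P u z) (P v z))) ⟩
        Σ[< n ] (λ z → ω y z * (P u z * P v z))
          ≈⟨ ΣωPP (ω·P uy) (ω·P vy) ⟩
        _ ∎

    S₃-moment : ∀ {u v w y} → Apart u y → Apart v y → Apart w y → fromℕ 6 * (r * s) * S₃ y u v w ≈
                cubic u v w + N * (- fromℕ 2 * Q 1F v w + - fromℕ 2 * Q 1F u w + - fromℕ 2 * Q 1F u v + - fromℕ 8)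
    S₃-moment {u} {v} {w} {y} uy vy wy = begin
      fromℕ 6 * (r * s) * S₃ y u v w
        ≈⟨ Σ-*ˡ (fromℕ 6 * (r * s)) (λ z → χ y z * (ε u z * (ε v z * ε w z))) ⟨
      Σ[< n ] (λ z → fromℕ 6 * (r * s) * (χ y z * (ε u z * (ε v z * ε w z))))
        ≈⟨ Σ-cong {n} (λ z → combine₄ (ω≈6χ y z) (ω·P≈ω·rε uy z) (ω·P≈ω·rε vy z) (ω·P≈ω·rε wy z)
             (solve 9 (λ r c d e f w p o l → con (+ 6) :* (r :* (r :* r)) :* (c :* (d :* (e :* f))) :+ :- (w :* (p :* (o :* l))) :=
                (:- (r :* d :* (r :* e :* (r :* f)))) :* (w :+ :- (con (+ 6) :* c))
                :+ (:- (o :* l)) :* (w :* p :+ :- (w :* (r :* d)))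
                :+ (:- (r :* d :* l)) :* (w :* o :+ :- (w :* (r :* e)))
                :+ (:- (r :* d :* (r :* e))) :* (w :* l :+ :- (w :* (r :* f))))
               refl r (χ y z) (ε u z) (ε v z) (ε w z) (ω y z) (P u z) (P v z) (P w z))) ⟩
      Σ[< n ] (λ z → ω y z * (P u z * (P v z * P w z)))
        ≈⟨ ΣωPPP (ω·P uy) (ω·P vy) (ω·P wy) ⟩
      _ ≈⟨ solve 5 (λ T N a b c → let k = :- con (+ 1) :+ :- con (+ 1) in
             T :+ N :* (k :* a :+ k :* b :+ k :* c :+ k :* k :* k) :=
             T :+ N :* ((:- con (+ 2)) :* a :+ (:- con (+ 2)) :* b :+ (:- con (+ 2)) :* c :+ :- con (+ 8)))
           refl (cubic u v w) N (Q 1F v w) (Q 1F u w) (Q 1F u v) ⟩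
      _ ∎

    -- Over the class of u itself the offsets are 4, -2, -2 instead of -2, -2, -2. The extra term on
    -- the left is the diagonal error s - r at z = u, where `ω` is 6.
    S₃-moment-own : ∀ {u v w} → Apart v u → Apart w u →
      fromℕ 6 * (r * s) * S₃ u u v w + fromℕ 6 * ((s + - r) * s * (ε v u * ε w u)) ≈
      cubic u v w + N * (fromℕ 4 * Q 1F v w + - fromℕ 2 * Q 1F u w + - fromℕ 2 * Q 1F u v + fromℕ 16)
    S₃-moment-own {u} {v} {w} vu wu = begin
      fromℕ 6 * (r * s) * S₃ u u v w + fromℕ 6 * ((s + - r) * s * (ε v u * ε w u))
        ≈⟨ +-congˡ (*-congʳ ωuu≈6) ⟨
      fromℕ 6 * (r * s) * S₃ u u v w + ω u u * ((s + - r) * s * (ε v u * ε w u))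
        ≈⟨ +-congˡ (Σ-idM u (λ z → ω u z * ((s + - r) * s * (ε v z * ε w z)))) ⟨
      fromℕ 6 * (r * s) * S₃ u u v w + Σ[< n ] (λ z → idM F u z * (ω u z * ((s + - r) * s * (ε v z * ε w z))))
        ≈⟨ Σ-*+ (fromℕ 6 * (r * s)) (λ z → χ u z * (ε u z * (ε v z * ε w z))) (λ z → idM F u z * (ω u z * ((s + - r) * s * (ε v z * ε w z)))) ⟨
      Σ[< n ] (λ z → fromℕ 6 * (r * s) * (χ u z * (ε u z * (ε v z * ε w z))) + idM F u z * (ω u z * ((s + - r) * s * (ε v z * ε w z))))
        ≈⟨ Σ-cong {n} (λ z → combine₄ (ω≈6χ u z) (P≈rε u z) (ω·P≈ω·rε vu z) (ω·P≈ω·rε wu z)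
             (solve 11 (λ r c d e f w p o l i k → con (+ 6) :* (r :* (r :* r)) :* (c :* (d :* (e :* f)))
                  :+ i :* (w :* (k :* (r :* r) :* (e :* f))) :+ :- (w :* (p :* (o :* l))) :=
                (:- (r :* d :* (r :* e :* (r :* f)))) :* (w :+ :- (con (+ 6) :* c))
                :+ (:- (w :* (r :* e) :* (r :* f))) :* (p :+ :- (r :* d :+ i :* k))
                :+ (:- (p :* l)) :* (w :* o :+ :- (w :* (r :* e)))
                :+ (:- (p :* (r :* e))) :* (w :* l :+ :- (w :* (r :* f))))
               refl r (χ u z) (ε u z) (ε v z) (ε w z) (ω u z) (P u z) (P v z) (P w z) (idM F u z) (s + - r))) ⟩
      Σ[< n ] (λ z → ω u z * (P u z * (P v z * P w z)))
        ≈⟨ ΣωPPP (ω·P (Q₄-diag u)) (ω·P vu) (ω·P wu) ⟩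
      _ ≈⟨ solve 5 (λ T N a b c → let k = :- con (+ 1) :+ :- con (+ 1) in let j = con (+ 5) :+ :- con (+ 1) in
             T :+ N :* (j :* a :+ k :* b :+ k :* c :+ j :* k :* k) :=
             T :+ N :* (con (+ 4) :* a :+ (:- con (+ 2)) :* b :+ (:- con (+ 2)) :* c :+ con (+ 16)))
           refl (cubic u v w) N (Q 1F v w) (Q 1F u w) (Q 1F u v) ⟩
      _ ∎
      where
      ωuu≈6 : ω u u ≈ fromℕ 6
      ωuu≈6 = combine₁ (Q₄-diag u) (solve 1 (λ a → con (+ 1) :+ a :+ :- con (+ 6) := con (+ 1) :* (a :+ :- con (+ 5))) refl (Q 4F u u))

    -- Subtracting the two moments cancels `cubic` and the terms in Q₁(u,v) and Q₁(u,w). What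
    -- remains is N(6Q₁(v,w) + 24), with Q₁(v,w) = 2 + r`ε v w`.
    S₃-difference : ∀ {u v w y} → Apart v w → Apart v u → Apart w u → Apart u y → Apart v y → Apart w y →
      r * (fromℕ 2 * (S₃ u u v w + - S₃ y u v w + - (ε v u * ε w u)) + - ((s + - fromℕ 1) * ε v w)) ≈
      fromℕ 6 * (s + - fromℕ 1) + - (fromℕ 2 * s * (ε v u * ε w u))
    S₃-difference {u} {v} {w} {y} vw vu wu uy vy wy = *-cancel-≉0 s≉0 (*-cancel-≉0 (fromℕ-≉0 5) (combine₃
      (+-cong (S₃-moment-own vu wu) (-‿cong (S₃-moment uy vy wy))) (Q₁-apart vw) 2N≈s[s-1]
      (solve 10 (λ r X Y c e N T a a′ a″ → let s = r :* r in
        con (+ 6) :* (s :* (r :* (con (+ 2) :* (X :+ :- Y :+ :- c) :+ :- ((s :+ :- con (+ 1)) :* e)))) :+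
          :- (con (+ 6) :* (s :* (con (+ 6) :* (s :+ :- con (+ 1)) :+ :- (con (+ 2) :* s :* c)))) :=
        con (+ 2) :* (con (+ 6) :* (r :* s) :* X :+ con (+ 6) :* ((s :+ :- r) :* s :* c) :+ :- (con (+ 6) :* (r :* s) :* Y) :+
          :- (T :+ N :* (con (+ 4) :* a :+ (:- con (+ 2)) :* a′ :+ (:- con (+ 2)) :* a″ :+ con (+ 16)) :+
            :- (T :+ N :* ((:- con (+ 2)) :* a :+ (:- con (+ 2)) :* a′ :+ (:- con (+ 2)) :* a″ :+ :- con (+ 8)))))
        :+ (con (+ 12) :* N) :* (a :+ :- (con (+ 2) :+ r :* e))
        :+ (con (+ 36) :+ con (+ 6) :* (r :* e)) :* (con (+ 2) :* N :+ :- (s :* (s :+ :- con (+ 1)))))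
        refl r (S₃ u u v w) (S₃ y u v w) (ε v u * ε w u) (ε v w) N (cubic u v w) (Q 1F v w) (Q 1F u w) (Q 1F u v))))

    -- Points in further classes.

    -- Three classes cover at most half of X: `f` sums to 3N - 6N < 0, but it is nonnegative
    -- wherever z lies in one of the three classes.
    outside : ∀ u v w → ∃ λ y → Apart u y × Apart v y × Apart w y
    outside u v w = [ (λ p → p) , (λ h → ⊥-elim (N≉0 (xy≈0⇒y≈0 (fromℕ-≉0 2) (nonneg-neg⇒≈0 3N≥0 (nonneg-cong total h))))) ]′
                    (Σ-find cases)
      where
      3N≥0 : Nonneg (fromℕ 3 * N)
      3N≥0 = nonneg-cong (solve 1 (λ N → N :+ (N :+ N) := con (+ 3) :* N) refl N)
        (+-nonneg (fromℕ-nonneg n) (+-nonneg (fromℕ-nonneg n) (fromℕ-nonneg n)))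

      f : Fin n → Carrier
      f z = ω u z + (ω v z + (ω w z + - fromℕ 6))

      total : Σ[< n ] f ≈ - (fromℕ 3 * N)
      total = trans (Σ-+ (ω u) (λ z → ω v z + (ω w z + - fromℕ 6))) (trans (+-cong (Σω u)
        (trans (Σ-+ (ω v) (λ z → ω w z + - fromℕ 6)) (+-cong (Σω v)
          (trans (Σ-+ (ω w) (λ z → - fromℕ 6)) (+-cong (Σω w) (Σ-const n (- fromℕ 6)))))))
        (solve 1 (λ N → N :+ (N :+ (N :+ N :* (:- con (+ 6)))) := :- (con (+ 3) :* N)) refl N))

      ω-6 : ∀ {x z} → Q 4F x z ≈ fromℕ 5 → ω x z + - fromℕ 6 ≈ 0#
      ω-6 {x} {z} e = combine₁ e (solve 1 (λ a → con (+ 1) :+ a :+ :- con (+ 6) :+ :- con (+ 0) := con (+ 1) :* (a :+ :- con (+ 5))) refl (Q 4F x z))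

      ω≥0 : ∀ x z → Nonneg (ω x z)
      ω≥0 x z = [ (λ e → nonneg-cong {fromℕ 6} (sym (x-y≈0⇒x≈y (ω-6 e))) (fromℕ-nonneg 6)) , (λ (e , _) → inj₁ (apart⇒ω≈0 e)) ]′ (Q₄∈5,-1 x z)

      cases : ∀ z → (Apart u z × Apart v z × Apart w z) ⊎ Nonneg (f z)
      cases z =
        [ (λ e → inj₂ (nonneg-cong (reorder₁ _ _ _ _) (+-nonneg (inj₁ (ω-6 e)) (+-nonneg (ω≥0 v z) (ω≥0 w z)))))
        , (λ (eu , _) →
          [ (λ e → inj₂ (nonneg-cong (reorder₂ _ _ _ _) (+-nonneg (inj₁ (ω-6 e)) (+-nonneg (ω≥0 u z) (ω≥0 w z)))))
          , (λ (ev , _) →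
            [ (λ e → inj₂ (nonneg-cong (reorder₃ _ _ _ _) (+-nonneg (inj₁ (ω-6 e)) (+-nonneg (ω≥0 u z) (ω≥0 v z)))))
            , (λ (ew , _) → inj₁ (eu , ev , ew)) ]′ (Q₄∈5,-1 w z)) ]′ (Q₄∈5,-1 v z)) ]′ (Q₄∈5,-1 u z)
        where
        reorder₁ : ∀ a b c d → (a + d) + (b + c) ≈ a + (b + (c + d))
        reorder₁ = solve 4 (λ a b c d → (a :+ d) :+ (b :+ c) := a :+ (b :+ (c :+ d))) refl
        reorder₂ : ∀ a b c d → (b + d) + (a + c) ≈ a + (b + (c + d))
        reorder₂ = solve 4 (λ a b c d → (b :+ d) :+ (a :+ c) := a :+ (b :+ (c :+ d))) refl
        reorder₃ : ∀ a b c d → (c + d) + (a + b) ≈ a + (b + (c + d))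
        reorder₃ = solve 4 (λ a b c d → (c :+ d) :+ (a :+ b) := a :+ (b :+ (c :+ d))) refl

    -- Integrality and the final contradiction.

    -- The summand r(s - 1)`ε u v` of 12`S₂` is cancelled by 6`ε u v` `S₁`. No r is left, so s is an
    -- integer.
    S₁S₂-relation : ∀ {u v y} → Apart u v → Apart u y → Apart v y →
                    fromℕ 2 * S₂ y u v + ε u v * S₁ y u + fromℕ 1 ≈ s
    S₁S₂-relation {u} {v} {y} uv uy vy = *-cancel-≉0 (fromℕ-≉0 5) (combine₂ (S₂-value uv uy vy) (S₁-value uy)
      (solve 5 (λ s r S₂ S₁ e → con (+ 6) :* (con (+ 2) :* S₂ :+ e :* S₁ :+ con (+ 1)) :+ :- (con (+ 6) :* s) :=
         con (+ 1) :* (con (+ 12) :* S₂ :+ :- ((s :+ :- con (+ 1)) :* (con (+ 6) :+ r :* e))) :+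
         e :* (con (+ 6) :* S₁ :+ :- (:- (r :* (s :+ :- con (+ 1)))))) refl s r (S₂ y u v) (S₁ y u) (ε u v)))

    -- Expand 4δδ′ = (1 + ε)(1 + ε′) and insert the known sums. The left side is 48 times the number
    -- of z in the class of y at which both signs are +1, which gives a divisibility condition.
    class-intersection : ∀ {u v y} → Apart u v → Apart u y → Apart v y →
      fromℕ 48 * Σ[< n ] (λ z → χ y z * (δ u z * δ v z)) ≈
      (s + - fromℕ 1) * (s + - (fromℕ 4 * r) + fromℕ 6 + r * ε u v)
    class-intersection {u} {v} {y} uv uy vy = begin
      fromℕ 48 * Σ[< n ] (λ z → χ y z * (δ u z * δ v z))
        ≈⟨ Σ-*ˡ (fromℕ 48) (λ z → χ y z * (δ u z * δ v z)) ⟨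
      Σ[< n ] (λ z → fromℕ 48 * (χ y z * (δ u z * δ v z)))
        ≈⟨ Σ-cong {n} (λ z → solve 3 (λ c a b → let e = a :+ a :+ :- con (+ 1) in let f = b :+ b :+ :- con (+ 1) in
             con (+ 48) :* (c :* (a :* b)) := con (+ 12) :* (c :* e) :+ (con (+ 12) :* (c :* f) :+ (con (+ 12) :* (c :* (e :* f)) :+ con (+ 12) :* c)))
             refl (χ y z) (δ u z) (δ v z)) ⟩
      Σ[< n ] (λ z → k * (χ y z * ε u z) + (k * (χ y z * ε v z) + (k * (χ y z * (ε u z * ε v z)) + k * χ y z)))
        ≈⟨ trans (Σ-*+ k (λ z → χ y z * ε u z) (λ z → k * (χ y z * ε v z) + (k * (χ y z * (ε u z * ε v z)) + k * χ y z))) (+-congˡ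
             (trans (Σ-*+ k (λ z → χ y z * ε v z) (λ z → k * (χ y z * (ε u z * ε v z)) + k * χ y z)) (+-congˡ
             (trans (Σ-*+ k (λ z → χ y z * (ε u z * ε v z)) (λ z → k * χ y z)) (+-cong (S₂-value uv uy vy) (Σ-*ˡ k (χ y))))))) ⟩
      k * S₁ y u + (k * S₁ y v + ((s + - fromℕ 1) * (fromℕ 6 + r * ε u v) + k * class-size y))
        ≈⟨ combine₄ (S₁-value uy) (S₁-value vy) (6·class-size y) 2N≈s[s-1]
             (solve 7 (λ s r a b c e N → con (+ 12) :* a :+ (con (+ 12) :* b :+ ((s :+ :- con (+ 1)) :* (con (+ 6) :+ r :* e) :+ con (+ 12) :* c))
                  :+ :- ((s :+ :- con (+ 1)) :* (s :+ :- (con (+ 4) :* r) :+ con (+ 6) :+ r :* e)) :=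
                con (+ 2) :* (con (+ 6) :* a :+ :- (:- (r :* (s :+ :- con (+ 1)))))
                :+ con (+ 2) :* (con (+ 6) :* b :+ :- (:- (r :* (s :+ :- con (+ 1)))))
                :+ con (+ 2) :* (con (+ 6) :* c :+ :- N)
                :+ con (+ 1) :* (con (+ 2) :* N :+ :- (s :* (s :+ :- con (+ 1)))))
               refl s r (S₁ y u) (S₁ y v) (class-size y) (ε u v) N) ⟩
      (s + - fromℕ 1) * (s + - (fromℕ 4 * r) + fromℕ 6 + r * ε u v) ∎
      where
      k : Carrier
      k = fromℕ 12

    s>0 : 0# < s
    s>0 = *-pos r>0 r>0

    contradiction-at-four-classes : ∀ {u v w y} → Apart u v → Apart u w → Apart v w →
                                    Apart u y → Apart v y → Apart w y → ⊥
    contradiction-at-four-classes {u} {v} {w} {y} uv uw vw uy vy wy = from-integer s-integer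
      where
      s-integer : IsInteger s
      s-integer = integer-cong (S₁S₂-relation uv uy vy)
        (integer-+ (integer-+ (integer-* (integer-fromℕ 2) (S₂-integer y u v)) (integer-* (ε-integer u v) (S₁-integer y u))) (integer-fromℕ 1))

      ab K X L : Carrier
      ab = ε v u * ε w u
      K = fromℕ 2 * (S₃ u u v w + - S₃ y u v w + - ab) + - ((s + - fromℕ 1) * ε v w)
      X = fromℕ 6 + - (fromℕ 2 * ab)
      L = K * K + - (s * (X * X)) + fromℕ 12 * X

      s-1-integer : IsInteger (s + - fromℕ 1)
      s-1-integer = integer-+ s-integer (integer-neg (integer-fromℕ 1))

      ab-integer : IsInteger ab
      ab-integer = integer-* (ε-integer v u) (ε-integer w u)

      K-integer : IsInteger K
      K-integer = integer-+ (integer-* (integer-fromℕ 2)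
          (integer-+ (integer-+ (S₃-integer u u v w) (integer-neg (S₃-integer y u v w))) (integer-neg ab-integer)))
        (integer-neg (integer-* s-1-integer (ε-integer v w)))

      X-integer : IsInteger X
      X-integer = integer-+ (integer-fromℕ 6) (integer-neg (integer-* (integer-fromℕ 2) ab-integer))

      L-integer : IsInteger L
      L-integer = integer-+ (integer-+ (integer-* K-integer K-integer) (integer-neg (integer-* s-integer (integer-* X-integer X-integer))))
        (integer-* (integer-fromℕ 12) X-integer)

      -- S₃-difference reads rK = sX - 6, so s divides (sX - 6)².
      sL≈36 : s * L ≈ fromℕ 36
      sL≈36 = combine₁ (S₃-difference vw (apart-sym uv) (apart-sym uw) uy vy wy)
        (solve 3 (λ r K c → let s = r :* r in let X = con (+ 6) :+ :- (con (+ 2) :* c) in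
           let R = con (+ 6) :* (s :+ :- con (+ 1)) :+ :- (con (+ 2) :* s :* c) in
           s :* (K :* K :+ :- (s :* (X :* X)) :+ con (+ 12) :* X) :+ :- con (+ 36) :=
           (r :* K :+ R) :* (r :* K :+ :- R)) refl r K ab)

      A : Carrier
      A = fromℕ 6 * S₁ y u

      A-integer : IsInteger A
      A-integer = integer-* (integer-fromℕ 6) (S₁-integer y u)

      -- Squaring -r(s - 1) replaces the possibly irrational r by s.
      A²≈s[s-1]² : A * A ≈ s * ((s + - fromℕ 1) * (s + - fromℕ 1))
      A²≈s[s-1]² = combine₁ (S₁-value uy)
        (solve 2 (λ r a → let s = r :* r in let b = r :* (s :+ :- con (+ 1)) in
          a :* a :+ :- (s :* ((s :+ :- con (+ 1)) :* (s :+ :- con (+ 1)))) := (a :+ :- b) :* (a :+ :- (:- b))) refl r A)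

      D-integer : IsInteger (Σ[< n ] (λ z → χ y z * (δ u z * δ v z)))
      D-integer = Σ-integer {n} (λ z → integer-* (χ-integer y z) (integer-* (δ-integer u z) (δ-integer v z)))

      s≉1 : ¬ s ≈ fromℕ 1
      s≉1 h = N≉0 (xy≈0⇒y≈0 (fromℕ-≉0 1) (trans 2N≈s[s-1] (trans (*-congˡ (x≈y⇒x-y≈0 h)) (zeroʳ s))))

      -- The square condition cannot exclude s = 36, where r is itself an integer. Positivity leaves
      -- r = 6, and 4 times the count `D` would be 35 or 70.
      s≉36 : ¬ s ≈ fromℕ 36
      s≉36 h = [ r≈6⇒⊥ , (λ e → pos⇒≉0 (+-pos r>0 (fromℕ-pos 5)) (trans (+-congʳ e) (-‿inverseˡ _))) ]′
               (xx≈yy⇒x≈±y {r} {fromℕ 6} (trans h (fromℕ-* 6 6)))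
        where
        D : Carrier
        D = Σ[< n ] (λ z → χ y z * (δ u z * δ v z))

        4D : r ≈ fromℕ 6 → fromℕ 4 * D ≈ fromℕ 35 * (fromℕ 1 + δ u v)
        4D e = *-cancel-≉0 (fromℕ-≉0 11) (combine₃ (class-intersection uv uy vy) h e
          -- At s = 36, r = 6 the right side of `class-intersection` is 35(18 + 6ε) = 420(1 + δ).
          (solve 4 (λ s r D d → let e = d :+ d :+ :- con (+ 1) in
            con (+ 12) :* (con (+ 4) :* D) :+ :- (con (+ 12) :* (con (+ 35) :* (con (+ 1) :+ d))) :=
            con (+ 1) :* (con (+ 48) :* D :+ :- ((s :+ :- con (+ 1)) :* (s :+ :- (con (+ 4) :* r) :+ con (+ 6) :+ r :* e)))
            :+ (s :+ con (+ 35) :+ :- (con (+ 4) :* r) :+ con (+ 6) :+ r :* e) :* (s :+ :- con (+ 36))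
            :+ (con (+ 35) :* (:- con (+ 4) :+ e)) :* (r :+ :- con (+ 6))) refl s r D (δ u v)))

        indivisible : ∀ k m → ¬ k ∣ m → ¬ fromℕ k * D ≈ fromℕ m
        indivisible k m k∤m e = k∤m (integer-∣ k m D-integer e)

        r≈6⇒⊥ : r ≈ fromℕ 6 → ⊥
        r≈6⇒⊥ r≈6 = [ (λ d≈0 → indivisible 4 35 (from-no (4 ∣? 35)) (combine₂ (4D r≈6) d≈0
                         (solve 2 (λ D d → con (+ 4) :* D :+ :- con (+ 35) := con (+ 1) :* (con (+ 4) :* D :+ :- (con (+ 35) :* (con (+ 1) :+ d)))
                            :+ con (+ 35) :* (d :+ :- con (+ 0))) refl D (δ u v))))
                    , (λ d≈1 → indivisible 4 70 (from-no (4 ∣? 70)) (combine₂ (4D r≈6) d≈1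
                         (solve 2 (λ D d → con (+ 4) :* D :+ :- con (+ 70) := con (+ 1) :* (con (+ 4) :* D :+ :- (con (+ 35) :* (con (+ 1) :+ d)))
                            :+ con (+ 35) :* (d :+ :- con (+ 1))) refl D (δ u v)))) ]′
                    (proj₁ (proj₂ (bit u v)))

      s≉member : ∀ {b} → s ≈ fromℕ b → ¬ b ∈ 1 ∷ 4 ∷ 9 ∷ 36 ∷ []
      s≉member h (here ≡.refl) = s≉1 h
      s≉member h (there (here ≡.refl)) = s-4≉0 (x≈y⇒x-y≈0 h)
      s≉member h (there (there (here ≡.refl))) = s-9≉0 (x≈y⇒x-y≈0 h)
      s≉member h (there (there (there (here ≡.refl)))) = s≉36 h

      from-integer : IsInteger s → ⊥
      from-integer (+ zero    , s≈) = s≉0 s≈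
      from-integer (-[1+ b ]  , s≈) = pos⇒≉0 (+-pos s>0 (fromℕ-pos b)) (trans (+-congʳ s≈) (-‿inverseˡ _))
      from-integer (+ suc b   , s≈) = s≉member {suc b} s≈
        (square-divisors-of-36 (suc b) (integer-∣ (suc b) 36 L-integer (trans (*-congʳ (sym s≈)) sL≈36))
          (integer-square b A-integer s≈ A²≈s[s-1]²))

    nonexistence : ⊥
    -- Repeated arguments let `outside` avoid fewer than three classes, so it provides the second,
    -- third and fourth class in turn.
    nonexistence = pick-v (outside x₀ x₀ x₀)
      where
      pick-y : ∀ {v w} → Apart x₀ v → Apart x₀ w → Apart v w → (∃ λ y → Apart x₀ y × Apart v y × Apart w y) → ⊥
      pick-y {v} {w} x₀v x₀w vw (y , x₀y , vy , wy) = contradiction-at-four-classes {x₀} {v} {w} {y} x₀v x₀w vw x₀y vy wy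

      pick-w : ∀ {v} → Apart x₀ v → (∃ λ w → Apart x₀ w × Apart v w × Apart v w) → ⊥
      pick-w {v} x₀v (w , x₀w , vw , _) = pick-y {v} {w} x₀v x₀w vw (outside x₀ v w)

      pick-v : (∃ λ v → Apart x₀ v × Apart x₀ v × Apart x₀ v) → ⊥
      pick-v (v , x₀v , _) = pick-w {v} x₀v (outside x₀ v v)

theorem4p1 : ∀ {c ℓ₁ ℓ₂} (F : RealClosedField c ℓ₁ ℓ₂) →
    let open RealClosedField F in
    (r : Carrier) → 0# < r →
    (n : ℕ) (S : AssociationScheme n 4) (E : Fin 5 → Mat F n) →
    IsPrimitiveIdempotents F S E →
    (q : Fin 5 → Fin 5 → Fin 5 → Carrier) →
    IsKreinParameters F E q →
    IsQPolynomial F q →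
    bStar F q zero ≈ (r * r + - fromℕ 4) →
    bStar F q (suc zero) ≈ (r * r + - fromℕ 9) →
    bStar F q (suc (suc zero)) ≈ fromℕ 10 →
    bStar F q (suc (suc (suc zero))) ≈ fromℕ 1 →
    cStar F q zero ≈ fromℕ 1 →
    cStar F q (suc zero) ≈ fromℕ 2 →
    cStar F q (suc (suc zero)) ≈ (r * r + - fromℕ 9) →
    cStar F q (suc (suc (suc zero))) ≈ (r * r + - fromℕ 4) →
    r ≈ fromℕ 9
theorem4p1 F r r>0 n S E prim q krein qpoly b₀ b₁ b₂ b₃ c₁ c₂ c₃ c₄ =
  ⊥-elim (KreinArray.nonexistence F r r>0 S E prim q krein qpoly b₀ b₁ b₂ b₃ c₁ c₂ c₃ c₄)
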